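{- Let $G$ be an $\widetilde{\mathfrak M}_c$-group. Then the Fitting subgroup of $G$ is nilpotent.
   Context: $G$ is a group, possibly equipped with additional first-order structure; "definable" means definable with parameters in this structure. For definable subgroups $H,N$ of $G$ with $N$ normalized by $H$, write $H/N$ for $H/(H\cap N)$ and, for $g_0,\dots,g_m\in H$, $C_{H/N}(g_0N,\dots,g_mN)$ for the centralizer in $H/N$ of these cosets. $G$ is an $\widetilde{\mathfrak M}_c$-group if for any two definable subgroups $H$ and $N$ of $G$ with $N$ normalized by $H$ there are natural numbers $n_{HN}$ and $d_{HN}$ such that every chain $C_{H/N}(g_0N)\geq C_{H/N}(g_0N,g_1N)\geq\cdots\geq C_{H/N}(g_0N,\dots,g_mN)\geq\cdots$ in which each group has index at least $d_{HN}$ in its predecessor has length at most $n_{HN}$. The Fitting subgroup of $G$ is the subgroup generated by all normal nilpotent subgroups of $G$. -}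

module Defs where

open import Level using (Level; _⊔_) renaming (suc to lsuc)
open import Data.Nat using (ℕ; zero; suc; _<_; _≤_; s≤s)
open import Data.Fin using (Fin; zero; suc; inject≤)
open import Data.List using (List; []; _∷_)
open import Data.List.Relation.Unary.All using (All)
open import Data.Product using (Σ; ∃; _×_; _,_)
open import Data.Sum using (_⊎_)
open import Data.Empty using (⊥)
open import Relation.Nullary using (¬_)
open import Relation.Binary.PropositionalEquality using (_≡_)
open import Algebra.Bundles using (Group)
import Data.Nat.Properties

-- First-order languages extending the language of groups

record Language : Set₁ where
  field
    Func : ℕ → Set   -- extra function symbols, by arity (constants: arity 0)
    Rel  : ℕ → Set

module Syntax (L : Language) where
  open Language L

  data Term (n : ℕ) : Set where
    var  : Fin n → Term n
    one  : Term n
    _·_  : Term n → Term n → Term n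
    inv  : Term n → Term n
    func : ∀ {k} → Func k → (Fin k → Term n) → Term n

  data Formula : ℕ → Set where
    _≐_  : ∀ {n} → Term n → Term n → Formula n
    rel  : ∀ {n k} → Rel k → (Fin k → Term n) → Formula n
    ⊥ᶠ   : ∀ {n} → Formula n
    _∧ᶠ_ : ∀ {n} → Formula n → Formula n → Formula n
    _∨ᶠ_ : ∀ {n} → Formula n → Formula n → Formula n
    _⇒ᶠ_ : ∀ {n} → Formula n → Formula n → Formula n
    ∀ᶠ   : ∀ {n} → Formula (suc n) → Formula n
    ∃ᶠ   : ∀ {n} → Formula (suc n) → Formula n

record Structure (L : Language) (c ℓ : Level) : Set (lsuc (c ⊔ ℓ)) where
  open Language L
  field
    group : Group c ℓ
  open Group group public
  field
    funcᴵ : ∀ {k} → Func k → (Fin k → Carrier) → Carrier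
    relᴵ  : ∀ {k} → Rel k → (Fin k → Carrier) → Set ℓ
    funcᴵ-cong : ∀ {k} (f : Func k) {xs ys : Fin k → Carrier} →
                 (∀ i → xs i ≈ ys i) → funcᴵ f xs ≈ funcᴵ f ys
    relᴵ-cong  : ∀ {k} (r : Rel k) {xs ys : Fin k → Carrier} →
                 (∀ i → xs i ≈ ys i) → relᴵ r xs → relᴵ r ys

module Semantics {L : Language} {c ℓ : Level} (M : Structure L c ℓ) where
  open Structure M
  open Syntax L

  extend : ∀ {n} → Carrier → (Fin n → Carrier) → Fin (suc n) → Carrier
  extend x ρ zero    = x
  extend x ρ (suc i) = ρ i

  ⟦_⟧ₜ : ∀ {n} → Term n → (Fin n → Carrier) → Carrier
  ⟦ var i ⟧ₜ ρ    = ρ i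
  ⟦ one ⟧ₜ ρ      = ε
  ⟦ s · t ⟧ₜ ρ    = ⟦ s ⟧ₜ ρ ∙ ⟦ t ⟧ₜ ρ
  ⟦ inv t ⟧ₜ ρ    = ⟦ t ⟧ₜ ρ ⁻¹
  ⟦ func f ts ⟧ₜ ρ = funcᴵ f (λ i → ⟦ ts i ⟧ₜ ρ)

  ⟦_⟧ : ∀ {n} → Formula n → (Fin n → Carrier) → Set (c ⊔ ℓ)
  ⟦ s ≐ t ⟧ ρ    = Level.Lift c (⟦ s ⟧ₜ ρ ≈ ⟦ t ⟧ₜ ρ)
  ⟦ rel r ts ⟧ ρ = Level.Lift c (relᴵ r (λ i → ⟦ ts i ⟧ₜ ρ))
  ⟦ ⊥ᶠ ⟧ ρ       = Level.Lift (c ⊔ ℓ) ⊥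
  ⟦ φ ∧ᶠ ψ ⟧ ρ   = ⟦ φ ⟧ ρ × ⟦ ψ ⟧ ρ
  ⟦ φ ∨ᶠ ψ ⟧ ρ   = ⟦ φ ⟧ ρ ⊎ ⟦ ψ ⟧ ρ
  ⟦ φ ⇒ᶠ ψ ⟧ ρ   = ⟦ φ ⟧ ρ → ⟦ ψ ⟧ ρ
  ⟦ ∀ᶠ φ ⟧ ρ     = ∀ x → ⟦ φ ⟧ (extend x ρ)
  ⟦ ∃ᶠ φ ⟧ ρ     = Σ Carrier λ x → ⟦ φ ⟧ (extend x ρ)

module GroupNotions {c ℓ : Level} (G : Group c ℓ) where
  open Group G

  Pred : ∀ p → Set (c ⊔ lsuc p)
  Pred p = Carrier → Set p

  record IsSubgroup {p} (H : Pred p) : Set (c ⊔ ℓ ⊔ p) where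
    field
      resp  : ∀ {x y} → x ≈ y → H x → H y
      ε∈    : H ε
      ∙-closed : ∀ {x y} → H x → H y → H (x ∙ y)
      ⁻¹-closed : ∀ {x} → H x → H (x ⁻¹)

  NormalizedBy : ∀ {p q} → Pred p → Pred q → Set (c ⊔ p ⊔ q)
  NormalizedBy N H = ∀ {h x} → H h → N x → N (h ∙ x ∙ h ⁻¹)

  IsNormal : ∀ {p} → Pred p → Set (c ⊔ p)
  IsNormal N = ∀ g {x} → N x → N (g ∙ x ∙ g ⁻¹)

  [_,_] : Carrier → Carrier → Carrier
  [ x , y ] = x ⁻¹ ∙ y ⁻¹ ∙ x ∙ y

  UpperCentral : ∀ {p} → Pred p → ℕ → Pred (c ⊔ ℓ ⊔ p)
  UpperCentral {p} S zero    x = Level.Lift (c ⊔ p) (x ≈ ε)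
  UpperCentral S (suc i) x = S x × (∀ y → S y → UpperCentral S i [ x , y ])

  IsNilpotent : ∀ {p} → Pred p → Set (c ⊔ ℓ ⊔ p)
  IsNilpotent S = Σ ℕ λ k → ∀ x → S x → UpperCentral S k x

  prod : List Carrier → Carrier
  prod []       = ε
  prod (x ∷ xs) = x ∙ prod xs

  -- The Fitting subgroup: subgroup generated by all normal nilpotent
  -- subgroups, i.e. the set of finite products of elements lying in
  -- normal nilpotent subgroups (these are closed under inverses).
  InNormalNilpotent : Pred (lsuc (c ⊔ ℓ))
  InNormalNilpotent x = Σ (Pred (c ⊔ ℓ)) λ N →
    IsSubgroup N × IsNormal N × IsNilpotent N × N x

  Fitting : Pred (lsuc (c ⊔ ℓ))
  Fitting g = Σ (List Carrier) λ xs → All InNormalNilpotent xs × g ≈ prod xs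

  -- Preimage in H of C_{H/N}(g₀N, …, g_mN):
  --   { h ∈ H | [h , gᵢ] ∈ N for all i ≤ m }
  CentMod : ∀ {p q} → Pred p → Pred q → ∀ {m} → (Fin m → Carrier) → Pred (p ⊔ q)
  CentMod H N gs h = H h × (∀ i → N [ h , gs i ])

  -- "A has index at least d in B" (A ≤ B): there are d elements of B lying
  -- in pairwise distinct left cosets of A.
  IndexAtLeast : ∀ {p q} → ℕ → Pred p → Pred q → Set (c ⊔ p ⊔ q)
  IndexAtLeast d A B = Σ (Fin d → Carrier) λ x →
    (∀ i → B (x i)) × (∀ i j → ¬ (i ≡ j) → ¬ A (x i ⁻¹ ∙ x j))

  take : ∀ {m} (k : ℕ) → k < m → (Fin m → Carrier) → Fin (suc k) → Carrier
  take k k<m gs i = gs (inject≤ i k<m)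

module _ {L : Language} {c ℓ : Level} (M : Structure L c ℓ) where
  open Structure M
  open Syntax L
  open Semantics M
  open GroupNotions group

  Defined : ∀ {m} → Formula (suc m) → (Fin m → Carrier) → Pred (c ⊔ ℓ)
  Defined φ a x = ⟦ φ ⟧ (extend x a)

  -- G is an M̃_c-group: for all definable subgroups H, N with N normalized
  -- by H there are n, d such that every chain
  --   C_{H/N}(g₀N) ≥ C_{H/N}(g₀N,g₁N) ≥ … ≥ C_{H/N}(g₀N,…,g_mN)
  -- with each index ≥ d has length m ≤ n.
  IsMcTilde : Set (c ⊔ ℓ)
  IsMcTilde =
    ∀ {m₁ m₂} (φ : Formula (suc m₁)) (a : Fin m₁ → Carrier)
              (ψ : Formula (suc m₂)) (b : Fin m₂ → Carrier) →
    IsSubgroup (Defined φ a) → IsSubgroup (Defined ψ b) →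
    NormalizedBy (Defined ψ b) (Defined φ a) →
    Σ ℕ λ n → Σ ℕ λ d →
      ∀ m (gs : Fin (suc m) → Carrier) →
      (∀ i → Defined φ a (gs i)) →
      (∀ k (k<m : k < m) →
         IndexAtLeast d
           (CentMod (Defined φ a) (Defined ψ b) (take (suc k) (s≤s k<m) gs))
           (CentMod (Defined φ a) (Defined ψ b) (take k (Data.Nat.Properties.m<n⇒m<1+n k<m) gs))) →
      m ≤ n

{-# OPTIONS --safe #-}

-- Write Z_i(D) for the upper central series of a subgroup D of the Fitting subgroup F. Every finite subset of D lies
-- in a nilpotent normal subgroup of D. This, together with bounds on indices, replaces exact centraliser conditions:
-- if D is locally nilpotent and all centralisers of elements of D in a section B/W have index < d in B, then D acts
-- nilpotently on B/W.
--
-- For each s there is a definable group E, normalised by D, with Z_s(D) ≤ E ∩ D ≤ Z_t(D) for some t. Given E for s,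
-- the chain condition in N(E)/E yields X = C_{N(E)/E}(g₀, …, g_m), gᵢ ∈ D, in which the centraliser of each element
-- of D has bounded index. Let Y be the almost centraliser of X modulo E (so D ≤ Y) and W that of Y. By symmetry W ∩ X
-- has finite index in X ≥ Z_{s+1}(D), and Z_{s+1}(D)W serves for s + 1. Consequently some nilpotent normal subgroup
-- M of D satisfies C_D(M/Z_s(D)) ≤ Z_t(D), and then D acts nilpotently on V/Z_s(D), for V normal in D, as soon as the
-- group it induces there is nilpotent.
--
-- Let now D = F ∩ C_G(g₀, …, g_m), and assume by induction along chains of centralisers that C_D(x) is nilpotent
-- whenever C_G(g₀, …, g_m, x) has large index in C_G(g₀, …, g_m). If this applies to some x ∈ Z_s(D), then
-- P = C_D(Z_s(D)) is nilpotent with D/P nilpotent, and each Z_i(P) is contained in some Z_n(D). Otherwise D has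
-- bounded orbits on its hypercentre, which is therefore some Z_n(D) and contains M, so D = Z_n(D).
module Submission where

open import Defs
open import Level using (Level; _⊔_; Lift; lift; lower) renaming (suc to lsuc)
open import Axiom.ExcludedMiddle using (ExcludedMiddle)
open import Algebra.Bundles using (Group)
open import Data.Bool using (Bool; true; false)
open import Data.Empty using (⊥; ⊥-elim)
open import Data.Fin using (Fin; zero; suc; toℕ; inject≤; inject₁; fromℕ)
import Data.Fin as Fin
import Data.Fin.Properties as Fin
open import Data.List using (List; []; _∷_; _++_; length; map; concatMap; tabulate; upTo; allFin)
import Data.List
open import Data.List.Membership.Propositional using (_∈_)
open import Data.List.Membership.Propositional.Properties
  using (∈-++⁺ˡ; ∈-++⁺ʳ; ∈-map⁺; ∈-concatMap⁺; ∈-lookup; ∈-upTo⁻; ∈-allFin)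
open import Data.List.Properties using (length-upTo)
open import Data.List.Relation.Unary.All as All using (All; []; _∷_)
open import Data.List.Relation.Unary.All.Properties using (tabulate⁻)
open import Data.List.Relation.Unary.AllPairs using (AllPairs; []; _∷_)
open import Data.List.Relation.Unary.AllPairs.Properties using (applyUpTo⁺₁)
open import Data.List.Relation.Unary.Any as Any using (here; there)
open import Data.List.Relation.Unary.Any.Properties using (lookup-index)
open import Data.Nat using (ℕ; zero; suc; _+_; _*_; _∸_; _≤_; _<_; pred; z≤n; s≤s; s≤s⁻¹)
import Data.Nat.Properties as ℕ
open import Data.Product using (Σ; ∃; _×_; _,_; proj₁; proj₂)
open import Data.Sum using (_⊎_; inj₁; inj₂; [_,_]′)
open import Data.Unit.Polymorphic using (⊤; tt)
open import Data.Vec using (Vec; lookup)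
open import Function.Bundles using (_⇔_; mk⇔; module Equivalence)
open import Relation.Binary.Definitions using (tri<; tri≈; tri>)
open import Relation.Binary.PropositionalEquality as ≡ using (_≡_)
import Relation.Binary.Reasoning.Setoid as SetoidReasoning
import Relation.Binary.Reflection as Reflection
open import Relation.Nullary using (¬_; Dec; yes; no)

-- Word identities in groups by free reduction.

module WordSolver {a b} (Γ : Group a b) where
  open Group Γ
  open SetoidReasoning setoid

  infixl 7 _⊕_
  infix 8 ⊖_

  data Word (n : ℕ) : Set where
    gen  : Fin n → Word n
    𝕖    : Word n
    _⊕_  : Word n → Word n → Word n
    ⊖_   : Word n → Word n

  ⟪_,_⟫ : ∀ {n} → Word n → Word n → Word n
  ⟪ x , y ⟫ = ⊖ x ⊕ ⊖ y ⊕ x ⊕ y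

  ⟦_⟧ : ∀ {n} → Word n → Vec Carrier n → Carrier
  ⟦ gen i ⟧ ρ = lookup ρ i
  ⟦ 𝕖 ⟧ ρ     = ε
  ⟦ x ⊕ y ⟧ ρ = ⟦ x ⟧ ρ ∙ ⟦ y ⟧ ρ
  ⟦ ⊖ x ⟧ ρ   = ⟦ x ⟧ ρ ⁻¹

  Letter : ℕ → Set
  Letter n = Bool × Fin n

  letter : ∀ {n} → Letter n → Vec Carrier n → Carrier
  letter (true  , i) ρ = lookup ρ i
  letter (false , i) ρ = lookup ρ i ⁻¹

  letters : ∀ {n} → List (Letter n) → Vec Carrier n → Carrier
  letters []       ρ = ε
  letters (l ∷ ls) ρ = letter l ρ ∙ letters ls ρ

  -- Cancelling against the head suffices: a letter put in front of a reduced list leaves nothing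
  -- else to cancel.
  push : ∀ {n} → Letter n → List (Letter n) → List (Letter n)
  push l [] = l ∷ []
  push (true , i) ((false , j) ∷ ls) with i Fin.≟ j
  ... | yes _ = ls
  ... | no  _ = (true , i) ∷ (false , j) ∷ ls
  push (false , i) ((true , j) ∷ ls) with i Fin.≟ j
  ... | yes _ = ls
  ... | no  _ = (false , i) ∷ (true , j) ∷ ls
  push (true , i) ((true , j) ∷ ls) = (true , i) ∷ (true , j) ∷ ls
  push (false , i) ((false , j) ∷ ls) = (false , i) ∷ (false , j) ∷ ls

  cancelˡ : ∀ {x y} z → x ∙ y ≈ ε → x ∙ (y ∙ z) ≈ z
  cancelˡ z xy≈ε = trans (sym (assoc _ _ z)) (trans (∙-congʳ xy≈ε) (identityˡ z))

  push-correct : ∀ {n} (l : Letter n) ls ρ → letters (push l ls) ρ ≈ letter l ρ ∙ letters ls ρ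
  push-correct l [] ρ = refl
  push-correct (true , i) ((false , j) ∷ ls) ρ with i Fin.≟ j
  ... | yes ≡.refl = sym (cancelˡ _ (inverseʳ _))
  ... | no  _ = refl
  push-correct (false , i) ((true , j) ∷ ls) ρ with i Fin.≟ j
  ... | yes ≡.refl = sym (cancelˡ _ (inverseˡ _))
  ... | no  _ = refl
  push-correct (true , i) ((true , j) ∷ ls) ρ = refl
  push-correct (false , i) ((false , j) ∷ ls) ρ = refl

  -- Normalisation with an accumulator. `reduce⁻` treats the formal inverse of its word, so inverses
  -- are driven to the letters, and words equal in the free group get the same list.
  reduce reduce⁻ : ∀ {n} → Word n → List (Letter n) → List (Letter n)
  reduce (gen i) ls = push (true , i) ls
  reduce 𝕖 ls       = ls
  reduce (x ⊕ y) ls = reduce x (reduce y ls)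
  reduce (⊖ x) ls   = reduce⁻ x ls
  reduce⁻ (gen i) ls = push (false , i) ls
  reduce⁻ 𝕖 ls       = ls
  reduce⁻ (x ⊕ y) ls = reduce⁻ y (reduce⁻ x ls)
  reduce⁻ (⊖ x) ls   = reduce x ls

  open import Algebra.Properties.Group Γ using (⁻¹-anti-homo-∙; ⁻¹-involutive; ε⁻¹≈ε)

  reduce-correct  : ∀ {n} (w : Word n) ls ρ → letters (reduce w ls) ρ ≈ ⟦ w ⟧ ρ ∙ letters ls ρ
  reduce⁻-correct : ∀ {n} (w : Word n) ls ρ → letters (reduce⁻ w ls) ρ ≈ ⟦ w ⟧ ρ ⁻¹ ∙ letters ls ρ
  reduce-correct (gen i) ls ρ = push-correct (true , i) ls ρ
  reduce-correct 𝕖 ls ρ = sym (identityˡ _)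
  reduce-correct (x ⊕ y) ls ρ = begin
    letters (reduce x (reduce y ls)) ρ    ≈⟨ reduce-correct x (reduce y ls) ρ ⟩
    ⟦ x ⟧ ρ ∙ letters (reduce y ls) ρ     ≈⟨ ∙-congˡ (reduce-correct y ls ρ) ⟩
    ⟦ x ⟧ ρ ∙ (⟦ y ⟧ ρ ∙ letters ls ρ)    ≈⟨ assoc _ _ _ ⟨
    ⟦ x ⊕ y ⟧ ρ ∙ letters ls ρ            ∎
  reduce-correct (⊖ x) ls ρ = reduce⁻-correct x ls ρ
  reduce⁻-correct (gen i) ls ρ = push-correct (false , i) ls ρ
  reduce⁻-correct 𝕖 ls ρ = sym (trans (∙-congʳ ε⁻¹≈ε) (identityˡ _))
  reduce⁻-correct (x ⊕ y) ls ρ = begin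
    letters (reduce⁻ y (reduce⁻ x ls)) ρ       ≈⟨ reduce⁻-correct y (reduce⁻ x ls) ρ ⟩
    ⟦ y ⟧ ρ ⁻¹ ∙ letters (reduce⁻ x ls) ρ      ≈⟨ ∙-congˡ (reduce⁻-correct x ls ρ) ⟩
    ⟦ y ⟧ ρ ⁻¹ ∙ (⟦ x ⟧ ρ ⁻¹ ∙ letters ls ρ)   ≈⟨ assoc _ _ _ ⟨
    ⟦ y ⟧ ρ ⁻¹ ∙ ⟦ x ⟧ ρ ⁻¹ ∙ letters ls ρ     ≈⟨ ∙-congʳ (⁻¹-anti-homo-∙ _ _) ⟨
    ⟦ x ⊕ y ⟧ ρ ⁻¹ ∙ letters ls ρ              ∎
  reduce⁻-correct (⊖ x) ls ρ = trans (reduce-correct x ls ρ) (∙-congʳ (sym (⁻¹-involutive _)))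

  ⟦_⇓⟧ : ∀ {n} → Word n → Vec Carrier n → Carrier
  ⟦ w ⇓⟧ ρ = letters (reduce w []) ρ

  open Reflection setoid gen ⟦_⟧ ⟦_⇓⟧
    (λ w ρ → trans (reduce-correct w [] ρ) (identityʳ _)) public using (solve; _⊜_)

-- Normal subgroups, commutators and index bounds.

module Basics {a b} (Γ : Group a b) where
  open Group Γ public
  open GroupNotions Γ public
  open WordSolver Γ using (solve; _⊜_; _⊕_; ⊖_; 𝕖; ⟪_,_⟫)

  record NormalSubgroup {p} (W : Pred p) : Set (a ⊔ b ⊔ p) where
    field
      isSubgroup : IsSubgroup W
      isNormal   : IsNormal W
    open IsSubgroup isSubgroup public

    conj : ∀ g {x} → W x → W (g ⁻¹ ∙ x ∙ g)
    conj g w = resp (solve 2 (λ g x → ⊖ g ⊕ x ⊕ ⊖ ⊖ g ⊜ ⊖ g ⊕ x ⊕ g) refl g _) (isNormal (g ⁻¹) w)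

    commˡ : ∀ {x} y → W x → W [ x , y ]
    commˡ {x} y w = resp (solve 2 (λ x y → ⊖ x ⊕ (⊖ y ⊕ x ⊕ y) ⊜ ⟪ x , y ⟫) refl x y)
      (∙-closed (⁻¹-closed w) (conj y w))

    commʳ : ∀ x {y} → W y → W [ x , y ]
    commʳ x {y} w = resp (solve 2 (λ x y → (⊖ x ⊕ ⊖ y ⊕ x) ⊕ y ⊜ ⟪ x , y ⟫) refl x y)
      (∙-closed (conj x (⁻¹-closed w)) w)

    -- The three subgroup lemma for elements: the Hall-Witt identity writes the third double
    -- commutator as a product of conjugates of the inverses of the other two.
    hallWitt : ∀ x f g → W [ [ f ⁻¹ , g ⁻¹ ] , x ] → W [ [ g , x ⁻¹ ] , f ⁻¹ ] → W [ [ x , f ] , g ]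
    hallWitt x f g p q = resp
      (solve 3 (λ x f g → ⊖ f ⊕ ⊖ (⊖ g ⊕ ⟪ ⟪ ⊖ f , ⊖ g ⟫ , x ⟫ ⊕ g ⊕ (⊖ x ⊕ ⟪ ⟪ g , ⊖ x ⟫ , ⊖ f ⟫ ⊕ x)) ⊕ f
                          ⊜ ⟪ ⟪ x , f ⟫ , g ⟫) refl x f g)
      (conj f (⁻¹-closed (∙-closed (conj g p) (conj x q))))

  module _ {p} {W : Pred p} (isSubgroup : IsSubgroup W) where
    open IsSubgroup isSubgroup

    comm-sym : ∀ {x y} → W [ x , y ] → W [ y , x ]
    comm-sym {x} {y} w = resp (solve 2 (λ x y → ⊖ ⟪ x , y ⟫ ⊜ ⟪ y , x ⟫) refl x y) (⁻¹-closed w)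

    cancel-left : ∀ {x y} → W x → W (x ⁻¹ ∙ y) → W y
    cancel-left {x} {y} u v = resp (solve 2 (λ x y → x ⊕ (⊖ x ⊕ y) ⊜ y) refl x y) (∙-closed u v)

    quotient-sym : ∀ {x y} → W (x ⁻¹ ∙ y) → W (y ⁻¹ ∙ x)
    quotient-sym {x} {y} w = resp (solve 2 (λ x y → ⊖ (⊖ x ⊕ y) ⊜ ⊖ y ⊕ x) refl x y) (⁻¹-closed w)

    quotient-common : ∀ z {x y} → W (z ⁻¹ ∙ x) → W (z ⁻¹ ∙ y) → W (x ⁻¹ ∙ y)
    quotient-common z {x} {y} u v =
      resp (solve 3 (λ x y z → ⊖ (⊖ z ⊕ x) ⊕ (⊖ z ⊕ y) ⊜ ⊖ x ⊕ y) refl x y z) (∙-closed (⁻¹-closed u) v)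

  comm-cong : ∀ {x x′ y y′} → x ≈ x′ → y ≈ y′ → [ x , y ] ≈ [ x′ , y′ ]
  comm-cong p q = ∙-cong (∙-cong (∙-cong (⁻¹-cong p) (⁻¹-cong q)) p) q

  centraliser-isSubgroup : ∀ {p q} {X : Pred p} {E : Pred q} {h} → IsSubgroup X → IsSubgroup E →
    (∀ {x e} → X x → E e → E (x ⁻¹ ∙ e ∙ x)) → (∀ {x e} → X x → E e → E (x ∙ e ∙ x ⁻¹)) →
    IsSubgroup (λ x → X x × E [ x , h ])
  centraliser-isSubgroup {h = h} subX subE conj conj′ = record
    { resp = λ x≈y (u , v) → X.resp x≈y u , E.resp (comm-cong x≈y refl) v
    ; ε∈ = X.ε∈ , E.resp (solve 1 (λ h → 𝕖 ⊜ ⟪ 𝕖 , h ⟫) refl h) E.ε∈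
    ; ∙-closed = λ {x} {y} (u , v) (u′ , v′) → X.∙-closed u u′ ,
        E.resp (solve 3 (λ x y h → (⊖ y ⊕ ⟪ x , h ⟫ ⊕ y) ⊕ ⟪ y , h ⟫ ⊜ ⟪ x ⊕ y , h ⟫) refl x y h)
          (E.∙-closed (conj u′ v) v′)
    ; ⁻¹-closed = λ {x} (u , v) → X.⁻¹-closed u ,
        E.resp (solve 2 (λ x h → x ⊕ ⊖ ⟪ x , h ⟫ ⊕ ⊖ x ⊜ ⟪ ⊖ x , h ⟫) refl x h) (conj′ u (E.⁻¹-closed v))
    }
    where module X = IsSubgroup subX
          module E = IsSubgroup subE

  -- The bound is strict, so `IndexBelow 0` is absurd. The record keeps `d`, `A` and `B` visible to
  -- unification, which the bare negation would not.
  record IndexBelow {p q} (d : ℕ) (A : Pred p) (B : Pred q) : Set (a ⊔ p ⊔ q) where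
    constructor below
    field
      ¬atLeast : ¬ IndexAtLeast d A B
  open IndexBelow public

  indexBelow-map : ∀ {p q p′ q′} {A : Pred p} {B : Pred q} {A′ : Pred p′} {B′ : Pred q′} {d} →
    IsSubgroup B′ → (∀ {x} → B′ x → B x) → (∀ {x} → B′ x → A x → A′ x) →
    IndexBelow d A B → IndexBelow d A′ B′
  indexBelow-map sub B′⊆B A⊆A′ (below small) = below λ (x , x∈ , distinct) → small
    (x , (λ i → B′⊆B (x∈ i)) , λ i j i≢j u → distinct i j i≢j (A⊆A′ (∙-closed (⁻¹-closed (x∈ i)) (x∈ j)) u))
    where open IsSubgroup sub

  indexBelow-≤ : ∀ {p q} {A : Pred p} {B : Pred q} {d e} → d ≤ e → IndexBelow d A B → IndexBelow e A B
  indexBelow-≤ d≤e (below small) = below λ (x , x∈ , distinct) → small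
    ((λ i → x (inject≤ i d≤e)) , (λ i → x∈ _) ,
     λ i j i≢j → distinct _ _ (λ eq → i≢j (Fin.inject≤-injective d≤e d≤e i j eq)))

  indexAtLeast-ordered : ∀ {p q} {A : Pred p} {B : Pred q} {d} → IsSubgroup A → (x : Fin d → Carrier) →
    (∀ i → B (x i)) → (∀ i j → i Fin.< j → ¬ A (x i ⁻¹ ∙ x j)) → IndexAtLeast d A B
  indexAtLeast-ordered {A = A} sub x x∈ distinct = x , x∈ , distinct′
    where
    distinct′ : ∀ i j → ¬ (i ≡ j) → ¬ A (x i ⁻¹ ∙ x j)
    distinct′ i j i≢j u with Fin.<-cmp i j
    ... | tri< i<j _ _ = distinct i j i<j u
    ... | tri≈ _ i≡j _ = i≢j i≡j
    ... | tri> _ _ j<i = distinct j i j<i (quotient-sym sub u)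

-- Finite index and coverings by cosets.

module FiniteIndex {a b} (Γ : Group a b) p (em : ExcludedMiddle (a ⊔ b ⊔ p)) where
  open Basics Γ public
  open WordSolver Γ using (solve; _⊜_; _⊕_; ⊖_; 𝕖; ⟪_,_⟫)

  Pd : Set (a ⊔ lsuc (a ⊔ b ⊔ p))
  Pd = Pred (a ⊔ b ⊔ p)

  byContradiction : {P : Set (a ⊔ b ⊔ p)} → ¬ ¬ P → P
  byContradiction {P} ¬¬p with em {P}
  ... | yes p = p
  ... | no ¬p = ⊥-elim (¬¬p ¬p)

  Covers : ∀ {k} → (Fin k → Carrier) → Pd → Pd → Set (a ⊔ b ⊔ p)
  Covers x A B = ∀ y → B y → ∃ λ i → A (x i ⁻¹ ∙ y)

  covers⇒index : ∀ {k d A B} {x : Fin k → Carrier} → IsSubgroup A → Covers x A B → k < d → IndexBelow d A B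
  covers⇒index {k} {d} {A} {B} {x} sub cov k<d = below collision
   where
   collision : ¬ IndexAtLeast d A B
   collision (y , y∈ , distinct) with Fin.pigeonhole k<d (λ i → proj₁ (cov (y i) (y∈ i)))
   ... | i , j , i<j , eq = distinct i j (Fin.<⇒≢ i<j)
    (quotient-common sub _ (proj₂ (cov (y i) (y∈ i)))
      (≡.subst (λ l → A (x l ⁻¹ ∙ y j)) (≡.sym eq) (proj₂ (cov (y j) (y∈ j)))))

  Cover : ℕ → Pd → Pd → Set (a ⊔ b ⊔ p)
  Cover d A B = Σ ℕ λ k → k < d × Σ (Fin k → Carrier) λ x → (∀ i → B (x i)) × Covers x A B

  -- A maximal family in pairwise distinct cosets represents every coset that meets B. It is built
  -- greedily; `fuel` counts how many elements can be added before `small` is violated.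
  index⇒cover : ∀ {d} {A B : Pd} → IsSubgroup A → IndexBelow d A B → Cover d A B
  index⇒cover {d} {A} {B} sub (below small) = grow d 0 (ℕ.+-identityʳ d) ((λ ()) , (λ ()) , λ ())
    where
    grow : ∀ fuel k → fuel + k ≡ d → IndexAtLeast k A B → Cover d A B
    grow zero k ≡.refl large = ⊥-elim (small large)
    grow (suc fuel) k eq (x , x∈ , distinct)
      with em {Σ Carrier λ y → B y × (∀ i → ¬ A (x i ⁻¹ ∙ y))}
    ... | yes (y , y∈ , new) = grow fuel (suc k) (≡.trans (ℕ.+-suc fuel k) eq)
            (indexAtLeast-ordered {B = B} sub x′ x′∈ distinct′)
      where
      x′ : Fin (suc k) → Carrier
      x′ zero = y
      x′ (suc i) = x i
      x′∈ : ∀ i → B (x′ i)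
      x′∈ zero = y∈
      x′∈ (suc i) = x∈ i
      distinct′ : ∀ i j → i Fin.< j → ¬ A (x′ i ⁻¹ ∙ x′ j)
      distinct′ zero (suc j) _ u = new j (quotient-sym sub u)
      distinct′ (suc i) (suc j) (s≤s i<j) = distinct i j (Fin.<⇒≢ i<j)
    ... | no none = k , ≡.subst (k <_) eq (ℕ.m<n+m k (s≤s z≤n)) , x , x∈ ,
            λ y y∈ → byContradiction λ none′ → none (y , y∈ , λ i u → none′ (i , u))

  -- Products of representatives are representatives. There are at most d * e of them, and the
  -- successor makes the bound strict.
  index-tower : ∀ {d e} {X Y Z : Pd} → IsSubgroup Y → IsSubgroup Z →
    IndexBelow d Y X → IndexBelow e Z Y → IndexBelow (suc (d * e)) Z X
  index-tower {d} {e} {X} {Y} {Z} subY subZ dY eZ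
    with index⇒cover subY dY | index⇒cover subZ eZ
  ... | k , k<d , x , _ , covX | l , l<e , y , _ , covY =
    covers⇒index {x = λ i → x (proj₁ (Fin.remQuot {k} l i)) ∙ y (proj₂ (Fin.remQuot {k} l i))} subZ
      (λ u u∈ → let i , v = covX u u∈ ; j , w = covY _ v in Fin.combine i j ,
        ≡.subst (λ (i , j) → Z ((x i ∙ y j) ⁻¹ ∙ u)) (≡.sym (Fin.remQuot-combine i j))
          (IsSubgroup.resp subZ
            (solve 3 (λ x y u → ⊖ y ⊕ (⊖ x ⊕ u) ⊜ ⊖ (x ⊕ y) ⊕ u) refl (x i) (y j) u) w))
      (s≤s (ℕ.*-mono-≤ (ℕ.<⇒≤ k<d) (ℕ.<⇒≤ l<e)))

  ∩-isSubgroup : ∀ {q r} {A : Pred q} {B : Pred r} → IsSubgroup A → IsSubgroup B → IsSubgroup (λ x → A x × B x)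
  ∩-isSubgroup subA subB = record
    { resp = λ eq (u , v) → A.resp eq u , B.resp eq v
    ; ε∈ = A.ε∈ , B.ε∈
    ; ∙-closed = λ (u , v) (u′ , v′) → A.∙-closed u u′ , B.∙-closed v v′
    ; ⁻¹-closed = λ (u , v) → A.⁻¹-closed u , B.⁻¹-closed v
    }
    where module A = IsSubgroup subA
          module B = IsSubgroup subB

  ⋂-isSubgroup : ∀ {i q} {I : Set i} {A : I → Pred q} → (∀ i → IsSubgroup (A i)) → IsSubgroup (λ x → ∀ i → A i x)
  ⋂-isSubgroup sub = record
    { resp = λ eq u i → IsSubgroup.resp (sub i) eq (u i)
    ; ε∈ = λ i → IsSubgroup.ε∈ (sub i)
    ; ∙-closed = λ u v i → IsSubgroup.∙-closed (sub i) (u i) (v i)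
    ; ⁻¹-closed = λ u i → IsSubgroup.⁻¹-closed (sub i) (u i)
    }

  index-∩ : ∀ {d e} {A A′ B : Pd} → IsSubgroup A → IsSubgroup A′ → IsSubgroup B →
    IndexBelow d A B → IndexBelow e A′ B → IndexBelow (suc (d * e)) (λ x → A x × A′ x) B
  index-∩ {d} subA subA′ subB dA eA′ = index-tower {d} (∩-isSubgroup subB subA) (∩-isSubgroup subA subA′)
    (indexBelow-map subB (λ u → u) (λ u v → u , v) dA)
    (indexBelow-map (∩-isSubgroup subB subA) proj₁ (λ (_ , u) v → u , v) eA′)

  index-⋂-bound : ℕ → ℕ → ℕ
  -- The empty intersection has index 1, and bounds are strict.
  index-⋂-bound d zero    = 2
  index-⋂-bound d (suc k) = suc (d * index-⋂-bound d k)

  index-⋂-bound-mono : ∀ d {k l} → k ≤ l → index-⋂-bound (suc d) k ≤ index-⋂-bound (suc d) l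
  index-⋂-bound-mono d {l = zero} z≤n = ℕ.≤-refl
  index-⋂-bound-mono d {l = suc l} z≤n =
    ℕ.≤-trans (index-⋂-bound-mono d {l = l} z≤n) (ℕ.m≤n⇒m≤1+n (ℕ.m≤m+n _ _))
  index-⋂-bound-mono d (s≤s k≤l) = s≤s (ℕ.*-monoʳ-≤ (suc d) (index-⋂-bound-mono d k≤l))

  index-⋂ : ∀ {d B} k (A : Fin k → Pd) → IsSubgroup B → (∀ i → IsSubgroup (A i)) →
    (∀ i → IndexBelow d (A i) B) → IndexBelow (index-⋂-bound d k) (λ x → ∀ i → A i x) B
  index-⋂ zero A subB subA small = below λ (x , _ , distinct) → distinct zero (suc zero) (λ ()) (λ ())
  index-⋂ {d} (suc k) A subB subA small =
    indexBelow-map subB (λ u → u) (λ _ (u , v) → λ { zero → u ; (suc i) → v i })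
      (index-∩ {d} (subA zero) (⋂-isSubgroup (λ i → subA (suc i))) subB (small zero)
        (index-⋂ k (λ i → A (suc i)) subB (λ i → subA (suc i)) (λ i → small (suc i))))

  index-⋂-finite : ∀ {B} k (A : Fin k → Pd) → IsSubgroup B → (∀ i → IsSubgroup (A i)) →
    (∀ i → ∃ λ d → IndexBelow d (A i) B) → ∃ λ d → IndexBelow d (λ x → ∀ i → A i x) B
  index-⋂-finite zero A subB subA small = 2 , index-⋂ {d = 0} zero A subB subA (λ ())
  index-⋂-finite (suc k) A subB subA small
    with small zero | index-⋂-finite k (λ i → A (suc i)) subB (λ i → subA (suc i)) (λ i → small (suc i))
  ... | d , small₀ | e , smallₛ = suc (d * e) , indexBelow-map subB (λ u → u) (λ _ (u , v) → λ { zero → u ; (suc i) → v i })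
    (index-∩ {d} (subA zero) (⋂-isSubgroup (λ i → subA (suc i))) subB small₀ smallₛ)

  private
    headCosets : ∀ {q} → List (Carrier × Fin (suc q)) → List Carrier
    headCosets [] = []
    headCosets ((g , zero) ∷ L) = g ∷ headCosets L
    headCosets ((g , suc i) ∷ L) = headCosets L

    tailCosets : ∀ {q} → List (Carrier × Fin (suc q)) → List (Carrier × Fin q)
    tailCosets [] = []
    tailCosets ((g , zero) ∷ L) = tailCosets L
    tailCosets ((g , suc i) ∷ L) = (g , i) ∷ tailCosets L

    ∈-headCosets : ∀ {q} (L : List (Carrier × Fin (suc q))) {g} → (g , zero) ∈ L → g ∈ headCosets L
    ∈-headCosets ((_ , zero) ∷ L) (here ≡.refl) = here ≡.refl
    ∈-headCosets ((_ , zero) ∷ L) (there g∈) = there (∈-headCosets L g∈)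
    ∈-headCosets ((_ , suc _) ∷ L) (there g∈) = ∈-headCosets L g∈

    ∈-tailCosets : ∀ {q} (L : List (Carrier × Fin (suc q))) {g i} → (g , suc i) ∈ L → (g , i) ∈ tailCosets L
    ∈-tailCosets ((_ , suc _) ∷ L) (here ≡.refl) = here ≡.refl
    ∈-tailCosets ((_ , zero) ∷ L) (there g∈) = ∈-tailCosets L g∈
    ∈-tailCosets ((_ , suc _) ∷ L) (there g∈) = there (∈-tailCosets L g∈)

  -- B. H. Neumann: if some coset y₀K₀ is missing from a finite cover of Y by cosets, it is covered
  -- by the cosets of the other subgroups; translating, so is every coset of K₀, and K₀ can be dropped.
  neumann : ∀ q (K : Fin q → Pd) (Y : Pd) → IsSubgroup Y → (∀ i → IsSubgroup (K i)) →
    (∀ i d → ¬ IndexBelow d (K i) Y) →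
    (L : List (Carrier × Fin q)) → Σ Carrier λ y → Y y × (∀ g i → (g , i) ∈ L → ¬ K i (g ⁻¹ ∙ y))
  neumann zero K Y subY subK infinite L = ε , IsSubgroup.ε∈ subY , λ _ ()
  neumann (suc q) K Y subY subK infinite L = result
    where
    module Y = IsSubgroup subY
    module K₀ = IsSubgroup (subK zero)
    module K (i : Fin q) = IsSubgroup (subK (suc i))
    heads = headCosets L

    missing : Σ Carrier λ y₀ → Y y₀ × (∀ g → g ∈ heads → ¬ K zero (g ⁻¹ ∙ y₀))
    missing = byContradiction λ none → infinite zero (suc (length heads))
      (covers⇒index {x = Data.List.lookup heads} (subK zero)
        (λ y y∈ → byContradiction λ out → none
          (y , y∈ , λ g g∈ u → out (Any.index g∈ , ≡.subst (λ g → K zero (g ⁻¹ ∙ y)) (lookup-index g∈) u)))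
        (ℕ.n<1+n _))

    y₀ = proj₁ missing

    Meets : Carrier → Set _
    Meets g = Σ Carrier λ g′ → Y g′ × K zero (g ⁻¹ ∙ g′)

    -- Left multiplication by y₀g′⁻¹ carries gK₀ = g′K₀ to the missing coset y₀K₀. The cosets listed
    -- here are those that it carries to the remaining cosets of `L`.
    translates : ∀ g → Dec (Meets g) → List (Carrier × Fin q)
    translates g (yes (g′ , _)) = map (λ (h , i) → g′ ∙ y₀ ⁻¹ ∙ h , i) (tailCosets L)
    translates g (no _) = []

    L′ : List (Carrier × Fin q)
    L′ = tailCosets L ++ concatMap (λ g → translates g em) heads

    result : Σ Carrier λ y → Y y × (∀ g i → (g , i) ∈ L → ¬ K i (g ⁻¹ ∙ y))
    result with neumann q (λ i → K (suc i)) Y subY (λ i → subK (suc i)) (λ i → infinite (suc i)) L′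
    ... | y , y∈ , avoid with em {Σ Carrier λ g → g ∈ heads × K zero (g ⁻¹ ∙ y)}
    ... | no none = y , y∈ , λ where
      g zero g∈ u → none (g , ∈-headCosets L g∈ , u)
      g (suc i) g∈ u → avoid g i (∈-++⁺ˡ (∈-tailCosets L g∈)) u
    ... | yes (g , g∈ , u) = moved em ≡.refl
      where
      -- The decision is generalised together with its equation, because `L′` was formed from this
      -- very `em`.
      moved : (dec : Dec (Meets g)) → em ≡ dec → Σ Carrier λ y → Y y × (∀ g i → (g , i) ∈ L → ¬ K i (g ⁻¹ ∙ y))
      moved (no none) _ = ⊥-elim (none (y , y∈ , u))
      moved (yes (g′ , g′∈ , u′)) eq =
        y₀ ∙ g′ ⁻¹ ∙ y , Y.∙-closed (Y.∙-closed (proj₁ (proj₂ missing)) (Y.⁻¹-closed g′∈)) y∈ , λ where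
          h zero h∈ v → proj₂ (proj₂ missing) h (∈-headCosets L h∈) (K₀.resp
            (solve 5 (λ h y₀ g′ y g → (⊖ h ⊕ (y₀ ⊕ ⊖ g′ ⊕ y)) ⊕ ⊖ (⊖ (⊖ g ⊕ g′) ⊕ (⊖ g ⊕ y)) ⊜ ⊖ h ⊕ y₀)
               refl h y₀ g′ y g)
            (K₀.∙-closed v (K₀.⁻¹-closed (K₀.∙-closed (K₀.⁻¹-closed u′) u))))
          h (suc i) h∈ v → avoid _ i
            (∈-++⁺ʳ (tailCosets L) (∈-concatMap⁺ (λ g → translates g em)
              (Any.map (λ { ≡.refl → ≡.subst (λ dec → (g′ ∙ y₀ ⁻¹ ∙ h , i) ∈ translates g dec) (≡.sym eq)
                              (∈-map⁺ _ (∈-tailCosets L h∈)) }) g∈)))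
            (K.resp i (solve 4 (λ h y₀ g′ y → ⊖ h ⊕ (y₀ ⊕ ⊖ g′ ⊕ y) ⊜ ⊖ (g′ ⊕ ⊖ y₀ ⊕ h) ⊕ y) refl h y₀ g′ y) v)

-- Relative upper central series.

module Series {a b} (Γ : Group a b) p (em : ExcludedMiddle (a ⊔ b ⊔ p)) where
  open FiniteIndex Γ p em public
  open WordSolver Γ using (solve; _⊜_; _⊕_; ⊖_; 𝕖; ⟪_,_⟫)

  Whole Trivial : Pd
  Whole _ = ⊤
  Trivial x = Lift (a ⊔ p) (x ≈ ε)

  whole-normal : NormalSubgroup Whole
  whole-normal = record
    { isSubgroup = record { resp = λ _ _ → tt ; ε∈ = tt ; ∙-closed = λ _ _ → tt ; ⁻¹-closed = λ _ → tt }
    ; isNormal = λ _ _ → tt }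

  trivial-normal : NormalSubgroup Trivial
  trivial-normal = record
    { isSubgroup = record
      { resp = λ x≈y (lift x≈ε) → lift (trans (sym x≈y) x≈ε)
      ; ε∈ = lift refl
      ; ∙-closed = λ (lift p) (lift q) → lift (trans (∙-cong p q) (identityˡ ε))
      ; ⁻¹-closed = λ {x} (lift p) → lift (trans (⁻¹-cong p) (solve 0 (⊖ 𝕖 ⊜ 𝕖) refl))
      }
    ; isNormal = λ g (lift p) → lift (trans (∙-congʳ (∙-congˡ p)) (solve 1 (λ g → g ⊕ 𝕖 ⊕ ⊖ g ⊜ 𝕖) refl g))
    }

  _∩_ : Pd → Pd → Pd
  (V ∩ W) x = V x × W x

  ∩-normal : ∀ {V W} → NormalSubgroup V → NormalSubgroup W → NormalSubgroup (V ∩ W)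
  ∩-normal V W = record
    { isSubgroup = ∩-isSubgroup (NormalSubgroup.isSubgroup V) (NormalSubgroup.isSubgroup W)
    ; isNormal = λ g (u , v) → NormalSubgroup.isNormal V g u , NormalSubgroup.isNormal W g v
    }

  -- Iterated fixed points of S acting by conjugation modulo W. In contrast to `UpperCentral`, x is
  -- not asked to lie in S, so that one definition serves both for nilpotent groups and for
  -- nilpotent actions on sections.
  Up : Pd → Pd → ℕ → Pd
  Up W S zero    x = W x
  Up W S (suc i) x = ∀ y → S y → Up W S i [ x , y ]

  Z : ℕ → Pd
  Z = Up Trivial Whole

  module _ {W S : Pd} (nW : NormalSubgroup W) (nS : NormalSubgroup S) where

    Up-normal : ∀ i → NormalSubgroup (Up W S i)
    Up-normal zero = nW
    Up-normal (suc i) = record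
      { isSubgroup = record
        { resp = λ x≈y u s s∈ → U.resp (comm-cong x≈y refl) (u s s∈)
        ; ε∈ = λ s s∈ → U.resp (solve 1 (λ h → 𝕖 ⊜ ⟪ 𝕖 , h ⟫) refl s) U.ε∈
        ; ∙-closed = λ {x} {y} u v s s∈ → U.resp
            (solve 3 (λ x y h → (⊖ y ⊕ ⟪ x , h ⟫ ⊕ y) ⊕ ⟪ y , h ⟫ ⊜ ⟪ x ⊕ y , h ⟫) refl x y s)
            (U.∙-closed (U.conj y (u s s∈)) (v s s∈))
        ; ⁻¹-closed = λ {x} u s s∈ → U.resp
            (solve 2 (λ x h → x ⊕ ⊖ ⟪ x , h ⟫ ⊕ ⊖ x ⊜ ⟪ ⊖ x , h ⟫) refl x s)
            (U.isNormal x (U.⁻¹-closed (u s s∈)))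
        }
      ; isNormal = λ g {x} u s s∈ → U.resp
          (solve 3 (λ g x s → g ⊕ ⟪ x , ⊖ g ⊕ s ⊕ g ⟫ ⊕ ⊖ g ⊜ ⟪ g ⊕ x ⊕ ⊖ g , s ⟫) refl g x s)
          (U.isNormal g (u _ (NormalSubgroup.conj nS g s∈)))
      }
      where module U = NormalSubgroup (Up-normal i)

    Up-suc : ∀ i {x} → Up W S i x → Up W S (suc i) x
    Up-suc i {x} u s s∈ = NormalSubgroup.commˡ (Up-normal i) {x} s u

    Up-≤ : ∀ {i j} → i ≤ j → ∀ {x} → Up W S i x → Up W S j x
    Up-≤ i≤j = go (ℕ.≤⇒≤′ i≤j)
      where
      open Data.Nat using (_≤′_; ≤′-refl; ≤′-step)
      go : ∀ {i j} → i ≤′ j → ∀ {x} → Up W S i x → Up W S j x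
      go ≤′-refl u = u
      go {j = suc j} (≤′-step i≤j) {x} u = Up-suc j {x} (go i≤j u)

    Up-pred : ∀ i {x y} → S y → Up W S i x → Up W S (pred i) [ x , y ]
    Up-pred zero {y = y} s∈ u = NormalSubgroup.commˡ nW y u
    Up-pred (suc i) s∈ u = u _ s∈

  Z-normal : ∀ i → NormalSubgroup (Z i)
  Z-normal = Up-normal trivial-normal whole-normal

  Up-resp-⊆ : ∀ {W W′ S S′ : Pd} → (∀ {x} → W x → W′ x) → (∀ {x} → S′ x → S x) → ∀ i {x} → Up W S i x → Up W′ S′ i x
  Up-resp-⊆ W⊆W′ S′⊆S zero u = W⊆W′ u
  Up-resp-⊆ W⊆W′ S′⊆S (suc i) u s s∈ = Up-resp-⊆ W⊆W′ S′⊆S i (u s (S′⊆S s∈))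

  Up-+ : ∀ {W S} i j {x} → Up (Up W S i) S j x → Up W S (j + i) x
  Up-+ i zero u = u
  Up-+ i (suc j) u s s∈ = Up-+ i j (u s s∈)

  Up-⋂ : ∀ {V : Pd} {W : Carrier → Pd} {S} k {x} →
    (∀ v → V v → Up (W v) S k x) → Up (λ y → ∀ v → V v → W v y) S k x
  Up-⋂ zero u = u
  Up-⋂ {V} (suc k) u s s∈ = Up-⋂ {V} k (λ v v∈ → u v v∈ s s∈)

  -- Failure to lie in the series involves only finitely many elements of S; local nilpotency can
  -- therefore trade S for a nilpotent normal subgroup.
  Up-witnesses : ∀ {W S} k {x} → ¬ Up W S k x →
    Σ (List Carrier) λ ys → All S ys × (∀ N → All N ys → ¬ Up W N k x)
  Up-witnesses zero u = [] , [] , λ _ _ → u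
  Up-witnesses {W} {S} (suc k) {x} u with em {Σ Carrier λ y → S y × ¬ Up W S k [ x , y ]}
  ... | no none = ⊥-elim (u λ y y∈ → byContradiction λ v → none (y , y∈ , v))
  ... | yes (y , y∈ , v) with Up-witnesses k v
  ... | ys , ys∈ , outside = y ∷ ys , y∈ ∷ ys∈ , λ { N (y∈N ∷ ys∈N) v → outside N ys∈N (v y y∈N) }

  -- B is closed under commutators, so once a step adds no element of B, the series is stationary on
  -- B. A series that reaches x, but not by step m, must therefore grow inside B at every earlier
  -- step.
  Up-strict : ∀ {W B N : Pd} → NormalSubgroup W → NormalSubgroup B → NormalSubgroup N → ∀ {k m x} →
    B x → Up W N k x → ¬ Up W N m x → ∀ j → j < m → Σ Carrier λ y → B y × Up W N (suc j) y × ¬ Up W N j y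
  Up-strict {W} {B} {N} nW nB nN {k} {m} {x} x∈ u v j j<m = byContradiction λ none →
    v (Up-≤ nW nN (ℕ.<⇒≤ j<m) (stationary none k x∈ (Up-≤ nW nN (ℕ.m≤m+n k j) u)))
    where
    stationary : ¬ (Σ Carrier λ y → B y × Up W N (suc j) y × ¬ Up W N j y) →
      ∀ i {y} → B y → Up W N (i + j) y → Up W N j y
    stationary none zero y∈ u = u
    stationary none (suc i) {y} y∈ u = byContradiction λ v → none
      (y , y∈ , (λ s s∈ → stationary none i (NormalSubgroup.commˡ nB s y∈) (u s s∈)) , v)

  -- Local nilpotency and nilpotent actions.

  Nilpotent : Pd → Set (a ⊔ b ⊔ p)
  Nilpotent N = Σ ℕ λ k → ∀ {x} → N x → Up Trivial N k x

  LocallyNilpotent : Set (a ⊔ lsuc (a ⊔ b ⊔ p))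
  LocallyNilpotent = ∀ xs → Σ Pd λ N → NormalSubgroup N × Nilpotent N × All N xs

  nilpotent⇒Up : ∀ {W N : Pd} → NormalSubgroup W → (nil : Nilpotent N) → ∀ {x} → N x → Up W N (proj₁ nil) x
  nilpotent⇒Up {W} nW (k , nil) x∈ = Up-resp-⊆ (λ (lift x≈ε) → W.resp (sym x≈ε) W.ε∈) (λ u → u) k (nil x∈)
    where module W = NormalSubgroup nW

  Cent : Pd → Pd → Pd
  Cent V W = Up W V 1

  cent-normal : ∀ {V W} → NormalSubgroup V → NormalSubgroup W → NormalSubgroup (Cent V W)
  cent-normal nV nW = Up-normal nW nV 1

  -- Otherwise x and finitely many witnesses lie in a nilpotent normal N whose series modulo A grows
  -- strictly d times; one new element per step gives d distinct cosets of A.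
  finiteIndex⇒Up : LocallyNilpotent → ∀ {A d} → NormalSubgroup A → IndexBelow d A Whole → ∀ x → Up A Whole d x
  finiteIndex⇒Up locNil {A} {d} nA (below small) x = byContradiction λ out →
    let ys , _ , outside = Up-witnesses d out
        N , nN , nil , xs∈ = locNil (x ∷ ys)
        step : ∀ (j : Fin d) → Σ Carrier λ y → ⊤ × Up A N (suc (toℕ j)) y × ¬ Up A N (toℕ j) y
        step j = Up-strict nA whole-normal nN {k = proj₁ nil} tt (nilpotent⇒Up nA nil (All.head xs∈)) (outside N (All.tail xs∈)) (toℕ j) (Fin.toℕ<n j)
    in small (indexAtLeast-ordered {B = Whole} (NormalSubgroup.isSubgroup nA) (λ j → proj₁ (step j)) _
      λ i j i<j u → proj₂ (proj₂ (proj₂ (step j)))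
        (cancel-left (NormalSubgroup.isSubgroup (Up-normal nA nN (toℕ j)))
          (Up-≤ nA nN i<j (proj₁ (proj₂ (proj₂ (step i)))))
          (Up-≤ nA nN (z≤n {toℕ j}) u)))

  -- The centraliser of v modulo W has fewer than d conjugates, each of index below d. Their
  -- intersection is normal of bounded index, so `finiteIndex⇒Up` applies; since the bound is
  -- uniform in v, the results can be intersected over V.
  boundedOrbits⇒Up : LocallyNilpotent → ∀ {V W d} → NormalSubgroup W →
    (∀ v → V v → IndexBelow d (λ g → W [ g , v ]) Whole) → ∃ λ k → ∀ x → Up (Cent V W) Whole k x
  boundedOrbits⇒Up locNil {d = zero} nW small = 0 , λ x v v∈ →
    ⊥-elim (¬atLeast (small v v∈) ((λ ()) , (λ ()) , λ ()))
  boundedOrbits⇒Up locNil {V} {W} {d = suc d} nW small = bound , λ x → Up-⋂ {V} bound (orbit x)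
    where
    module W = NormalSubgroup nW
    -- Serves all v at once: at most `suc d` conjugates, each of index below `suc d`.
    bound = index-⋂-bound (suc d) (suc d)

    C : Carrier → Pd
    C v g = W [ g , v ]

    subC : ∀ v → IsSubgroup (C v)
    subC v = record
      { resp = λ x≈y u → W.resp (comm-cong x≈y refl) u
      ; ε∈ = W.resp (solve 1 (λ h → 𝕖 ⊜ ⟪ 𝕖 , h ⟫) refl v) W.ε∈
      ; ∙-closed = λ {x} {y} u w → proj₂ (IsSubgroup.∙-closed sub (tt , u) (tt , w))
      ; ⁻¹-closed = λ u → proj₂ (IsSubgroup.⁻¹-closed sub (tt , u))
      }
      where sub = centraliser-isSubgroup {X = Whole} {E = W} {v} (NormalSubgroup.isSubgroup whole-normal) W.isSubgroup
                    (λ {x} _ → W.conj x) (λ {x} _ → W.isNormal x)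

    core : Carrier → Pd
    core v g = ∀ b → C (b ∙ v ∙ b ⁻¹) g

    core-normal : ∀ v → NormalSubgroup (core v)
    core-normal v = record
      { isSubgroup = ⋂-isSubgroup (λ b → subC (b ∙ v ∙ b ⁻¹))
      ; isNormal = λ g {x} u b → W.resp
          (solve 4 (λ g x b v → g ⊕ ⟪ x , ⊖ g ⊕ b ⊕ v ⊕ ⊖ (⊖ g ⊕ b) ⟫ ⊕ ⊖ g ⊜ ⟪ g ⊕ x ⊕ ⊖ g , b ⊕ v ⊕ ⊖ b ⟫) refl g x b v)
          (W.isNormal g (u (g ⁻¹ ∙ b)))
      }

    orbit : ∀ x v → V v → Up (C v) Whole bound x
    orbit x v v∈ with index⇒cover (subC v) (small v v∈)
    ... | r , r<d , f , _ , cov = Up-resp-⊆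
      (λ {g} u → W.resp (comm-cong refl (solve 1 (λ v → 𝕖 ⊕ v ⊕ ⊖ 𝕖 ⊜ v) refl v)) (u ε)) (λ u → u) bound
      (finiteIndex⇒Up locNil (core-normal v)
        (indexBelow-≤ (index-⋂-bound-mono d (ℕ.<⇒≤ r<d))
          (indexBelow-map whole (λ u → u) (λ _ → inCore)
            (index-⋂ r (λ i → C (f i ∙ v ∙ f i ⁻¹)) whole (λ i → subC _) conjugate))) x)
      where
      whole = NormalSubgroup.isSubgroup whole-normal
      conjugate : ∀ i → IndexBelow (suc d) (C (f i ∙ v ∙ f i ⁻¹)) Whole
      conjugate i = below λ (x , _ , distinct) → ¬atLeast (small v v∈)
        ((λ j → f i ⁻¹ ∙ x j ∙ f i) , _ , λ j k j≢k u → distinct j k j≢k (W.resp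
          (solve 4 (λ f x y v → f ⊕ ⟪ ⊖ (⊖ f ⊕ x ⊕ f) ⊕ (⊖ f ⊕ y ⊕ f) , v ⟫ ⊕ ⊖ f ⊜ ⟪ ⊖ x ⊕ y , f ⊕ v ⊕ ⊖ f ⟫)
             refl (f i) (x j) (x k) v)
          (W.isNormal (f i) u)))
      -- b = f i ∙ c with c ∈ C v, so b v b⁻¹ and f i v (f i)⁻¹ agree modulo W.
      inCore : ∀ {g} → (∀ i → C (f i ∙ v ∙ f i ⁻¹) g) → core v g
      inCore {g} u b with cov b tt
      ... | i , w = W.resp
        (solve 4 (λ g f b v → let p = f ⊕ v ⊕ ⊖ f ; z = b ⊕ v ⊕ ⟪ ⊖ f ⊕ b , v ⟫ ⊕ ⊖ (b ⊕ v) in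
            (⊖ (p ⊕ g) ⊕ ⊖ z ⊕ (p ⊕ g)) ⊕ ⟪ g , p ⟫ ⊕ (⊖ p ⊕ z ⊕ p) ⊜ ⟪ g , b ⊕ v ⊕ ⊖ b ⟫) refl g (f i) b v)
        (W.∙-closed (W.∙-closed (W.conj (f i ∙ v ∙ f i ⁻¹ ∙ g) (W.⁻¹-closed (W.isNormal (b ∙ v) w))) (u i))
          (W.conj (f i ∙ v ∙ f i ⁻¹) (W.isNormal (b ∙ v) w)))

  module _ (K : ℕ → Pd) (subK : ∀ i → IsSubgroup (K i)) where
    private
      record Avoiding (n : ℕ) (L : List ℕ) : Set (a ⊔ b ⊔ p) where
        field
          element  : Carrier
          indices  : List ℕ
          large    : n ≤ length indices
          ordered  : AllPairs _<_ indices
          subset   : ∀ {i} → i ∈ indices → i ∈ L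
          outside  : ∀ {i} → i ∈ indices → ¬ K i element

      record Split (f : Carrier) (L : List ℕ) : Set (a ⊔ b ⊔ p) where
        field
          ins outs : List ℕ
          total    : length ins + length outs ≡ length L
          ordered  : AllPairs _<_ L → AllPairs _<_ ins × AllPairs _<_ outs
          ins⊆     : ∀ {i} → i ∈ ins → i ∈ L
          outs⊆    : ∀ {i} → i ∈ outs → i ∈ L
          inside   : ∀ {i} → i ∈ ins → K i f
          outside  : ∀ {i} → i ∈ outs → ¬ K i f

      restrict : ∀ {k : ℕ} {L L′ : List ℕ} → (∀ {i} → i ∈ L′ → i ∈ L) → All (k <_) L → All (k <_) L′
      restrict sub all = All.tabulate (λ i∈ → All.lookup all (sub i∈))

      split : ∀ f L → Split f L
      split f [] = record
        { ins = [] ; outs = [] ; total = ≡.refl ; ordered = λ _ → [] , []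
        ; ins⊆ = λ () ; outs⊆ = λ () ; inside = λ () ; outside = λ () }
      split f (k ∷ L) with em {K k f}
      ... | yes k∈ = record
        { ins = k ∷ ins ; outs = outs ; total = ≡.cong suc total
        ; ordered = λ { (k< ∷ ord) → (restrict ins⊆ k< ∷ proj₁ (ordered ord)) , proj₂ (ordered ord) }
        ; ins⊆ = λ { (here eq) → here eq ; (there i∈) → there (ins⊆ i∈) } ; outs⊆ = λ i∈ → there (outs⊆ i∈)
        ; inside = λ { (here ≡.refl) → k∈ ; (there i∈) → inside i∈ } ; outside = outside }
        where open Split (split f L)
      ... | no k∉ = record
        { ins = ins ; outs = k ∷ outs ; total = ≡.trans (ℕ.+-suc _ _) (≡.cong suc total)
        ; ordered = λ { (k< ∷ ord) → proj₁ (ordered ord) , (restrict outs⊆ k< ∷ proj₂ (ordered ord)) }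
        ; ins⊆ = λ i∈ → there (ins⊆ i∈) ; outs⊆ = λ { (here eq) → here eq ; (there i∈) → there (outs⊆ i∈) }
        ; inside = inside ; outside = λ { (here ≡.refl) → k∉ ; (there i∈) → outside i∈ } }
        where open Split (split f L)

      -- Either some f already avoids suc d of the subgroups, or discarding at most d of them puts f in all
      -- the remaining ones but the first; then multiplying by f affects avoidance of the first only.
      select : ∀ d j L → j * suc d ≤ length L → AllPairs _<_ L → (∀ {i} → i ∈ L → Σ Carrier λ f → ¬ K i f) →
        Avoiding (suc d) L ⊎ Avoiding j L
      select d zero L _ ord proper = inj₂ record
        { element = ε ; indices = [] ; large = z≤n ; ordered = [] ; subset = λ () ; outside = λ () }
      select d (suc j) (k ∷ L) (s≤s len) (k< ∷ ord) proper with proper (here ≡.refl)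
      ... | f , f∉ with split f L
      ... | s with suc d ℕ.≤? length (Split.outs s)
      ... | yes many = inj₁ record
        { element = f ; indices = outs ; large = many ; ordered = proj₂ (ordered ord)
        ; subset = λ i∈ → there (outs⊆ i∈) ; outside = outside }
        where open Split s
      ... | no few with select d j (Split.ins s) lenIns (proj₁ (Split.ordered s ord)) (λ i∈ → proper (there (Split.ins⊆ s i∈)))
        where
        open ℕ.≤-Reasoning
        lenIns : j * suc d ≤ length (Split.ins s)
        lenIns = ℕ.+-cancelˡ-≤ d _ _ (begin
          d + j * suc d                                    ≤⟨ len ⟩
          length L                                         ≡⟨ Split.total s ⟨
          length (Split.ins s) + length (Split.outs s)     ≤⟨ ℕ.+-monoʳ-≤ (length (Split.ins s)) (s≤s⁻¹ (ℕ.≰⇒> few)) ⟩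
          length (Split.ins s) + d                         ≡⟨ ℕ.+-comm (length (Split.ins s)) d ⟩
          d + length (Split.ins s)                         ∎)
      ... | inj₁ r = inj₁ record
        { element = element ; indices = indices ; large = large ; ordered = ordered
        ; subset = λ i∈ → there (Split.ins⊆ s (subset i∈)) ; outside = outside }
        where open Avoiding r
      ... | inj₂ r with em {K k (Avoiding.element r)}
      ... | no g∉ = inj₂ record
        { element = element ; indices = k ∷ indices ; large = s≤s large
        ; ordered = restrict (λ i∈ → Split.ins⊆ s (subset i∈)) k< ∷ ordered
        ; subset = λ { (here eq) → here eq ; (there i∈) → there (Split.ins⊆ s (subset i∈)) }
        ; outside = λ { (here ≡.refl) → g∉ ; (there i∈) → outside i∈ } }
        where open Avoiding r
      ... | yes g∈ = inj₂ record
        { element = element ∙ f ; indices = k ∷ indices ; large = s≤s large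
        ; ordered = restrict (λ i∈ → Split.ins⊆ s (subset i∈)) k< ∷ ordered
        ; subset = λ { (here eq) → here eq ; (there i∈) → there (Split.ins⊆ s (subset i∈)) }
        ; outside = λ where
            (here ≡.refl) u → f∉ (IsSubgroup.resp (subK k) (solve 2 (λ g f → ⊖ g ⊕ (g ⊕ f) ⊜ f) refl element f)
              (IsSubgroup.∙-closed (subK k) (IsSubgroup.⁻¹-closed (subK k) g∈) u))
            {i} (there i∈) u → outside i∈
              (IsSubgroup.resp (subK i) (solve 2 (λ g f → g ⊕ f ⊕ ⊖ f ⊜ g) refl element f)
                (IsSubgroup.∙-closed (subK i) u (IsSubgroup.⁻¹-closed (subK i) (Split.inside s (subset i∈))))) }
        where open Avoiding r

    -- The size d * d lets `select` run with j equal to the target size, and then both of its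
    -- outcomes avoid d subgroups.
    avoidMany : ∀ d → (∀ i → i < d * d → Σ Carrier λ f → ¬ K i f) →
      Σ Carrier λ f → Σ (Fin d → ℕ) λ i → (∀ {s t} → s Fin.< t → i s < i t) × (∀ s → ¬ K (i s) f)
    avoidMany zero proper = ε , (λ ()) , (λ { {()} }) , λ ()
    avoidMany (suc d) proper with select d (suc d) (upTo (suc d * suc d)) (ℕ.≤-reflexive (≡.sym (length-upTo _)))
        (applyUpTo⁺₁ _ _ (λ i<j _ → i<j)) (λ i∈ → proper _ (∈-upTo⁻ i∈))
    ... | r = element , (λ s → Data.List.lookup indices (inject≤ s large)) ,
              (λ {s} {t} s<t → increasing ordered (≡.subst₂ _<_ (≡.sym (Fin.toℕ-inject≤ s large)) (≡.sym (Fin.toℕ-inject≤ t large)) s<t)) ,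
              λ s → outside (∈-lookup (inject≤ s large))
      where
      open Avoiding ([ (λ r → r) , (λ r → r) ]′ r)
      increasing : ∀ {L} → AllPairs _<_ L → ∀ {s t} → s Fin.< t → Data.List.lookup L s < Data.List.lookup L t
      increasing (k< ∷ ord) {zero} {suc t} _ = All.lookup k< (∈-lookup t)
      increasing (k< ∷ ord) {suc s} {suc t} (s≤s s<t) = increasing ord s<t

  -- If the series is long, some f acts nontrivially on d of the sections U_{2i+2}/U_{2i}, and the elements it moves
  -- there lie in distinct cosets of its centraliser.
  boundedCentralisers⇒Up : LocallyNilpotent → ∀ {W B d} → NormalSubgroup W → NormalSubgroup B →
    (∀ f → IndexBelow d (λ x → B x × W [ x , f ]) B) → ∃ λ m → ∀ {x} → B x → Up W Whole m x
  boundedCentralisers⇒Up locNil {W} {B} {d} nW nB small = m , λ x∈ → byContradiction (contra x∈)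
    where
    module B = NormalSubgroup nB
    module W = NormalSubgroup nW
    -- N acts trivially on a single layer of its own series, so each of the d * d sections consists
    -- of two layers.
    m = d * d * 2
    contra : ∀ {x} → B x → ¬ ¬ Up W Whole m x
    contra {x} x∈ out with Up-witnesses m out
    ... | ys , _ , outside with locNil (x ∷ ys)
    ... | N , nN , nil , x∈N ∷ ys∈N = ¬atLeast (small f) (indexAtLeast-ordered {B = B}
            (centraliser-isSubgroup B.isSubgroup W.isSubgroup (λ {x} _ → W.conj x) (λ {x} _ → W.isNormal x))
            (λ s → proj₁ (moved s)) (λ s → proj₁ (proj₂ (moved s))) distinct)
      where
      U : ℕ → Pd
      U = Up W N
      module U i = NormalSubgroup (Up-normal nW nN i)

      K : ℕ → Pd
      K i f = ∀ y → B y → U (suc i * 2) y → U (i * 2) [ y , f ]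

      subK : ∀ i → IsSubgroup (K i)
      subK i = record
        { resp = λ f≈g k y y∈ u → U.resp (i * 2) (comm-cong refl f≈g) (k y y∈ u)
        ; ε∈ = λ y _ _ → U.resp (i * 2) (solve 1 (λ y → 𝕖 ⊜ ⟪ y , 𝕖 ⟫) refl y) (U.ε∈ (i * 2))
        ; ∙-closed = λ {f} {g} k l y y∈ u → U.resp (i * 2)
            (solve 3 (λ y f g → ⟪ y , g ⟫ ⊕ (⊖ g ⊕ ⟪ y , f ⟫ ⊕ g) ⊜ ⟪ y , f ⊕ g ⟫) refl y f g)
            (U.∙-closed (i * 2) (l y y∈ u) (U.conj (i * 2) g (k y y∈ u)))
        ; ⁻¹-closed = λ {f} k y y∈ u → U.resp (i * 2)
            (solve 2 (λ y f → f ⊕ ⊖ ⟪ y , f ⟫ ⊕ ⊖ f ⊜ ⟪ y , ⊖ f ⟫) refl y f)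
            (U.isNormal (i * 2) f (U.⁻¹-closed (i * 2) (k y y∈ u)))
        }

      proper : ∀ i → i < d * d → Σ Carrier λ f → ¬ K i f
      -- An element of B that appears in layer 2i + 2 and not before is moved modulo `U (i * 2)` by
      -- some f ∈ N.
      proper i i<
        with Up-strict nW nB nN {k = proj₁ nil} {m} x∈ (nilpotent⇒Up nW nil x∈N) (outside N ys∈N) (suc (i * 2))
               (ℕ.≤-trans (ℕ.*-monoˡ-≤ 2 i<) ℕ.≤-refl)
      ... | y , y∈ , u , v with em {Σ Carrier λ f → N f × ¬ U (i * 2) [ y , f ]}
      ... | yes (f , _ , w) = f , λ k → w (k y y∈ u)
      ... | no none = ⊥-elim (v λ f f∈ → byContradiction λ w → none (f , f∈ , w))

      avoiding = avoidMany K subK d proper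
      f = proj₁ avoiding
      index = proj₁ (proj₂ avoiding)

      moved : ∀ s → Σ Carrier λ y → B y × U (suc (index s) * 2) y × ¬ U (index s * 2) [ y , f ]
      moved s = byContradiction λ none → proj₂ (proj₂ (proj₂ avoiding)) s
        λ y y∈ u → byContradiction λ w → none (y , y∈ , u , w)

      distinct : ∀ s t → s Fin.< t → ¬ (B _ × W [ proj₁ (moved s) ⁻¹ ∙ proj₁ (moved t) , f ])
      -- As s < t, the element y already lies in `U (index t * 2)`. If y⁻¹z commuted with f modulo
      -- W, then f could not move z modulo that subgroup.
      distinct s t s<t (_ , w) with moved s | moved t
      ... | y , _ , u , _ | z , _ , _ , v = v (U.resp j
        (solve 3 (λ y z f → (⊖ (⊖ y ⊕ z) ⊕ ⟪ y , f ⟫ ⊕ (⊖ y ⊕ z)) ⊕ ⟪ ⊖ y ⊕ z , f ⟫ ⊜ ⟪ z , f ⟫) refl y z f)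
        (U.∙-closed j (U.conj j (y ⁻¹ ∙ z) (U.commˡ j {y} f (Up-≤ nW nN (ℕ.*-monoˡ-≤ 2 (proj₁ (proj₂ (proj₂ avoiding)) s<t)) u)))
          (Up-≤ nW nN (z≤n {j}) w)))
        where j = index t * 2

  -- [V , Γ, …, Γ , M] can be moved to [V , M , Γ, …, Γ] at the cost of terms [V , [M , Γ, …, Γ]], which vanish
  -- once the inner commutator is long, because Γ is nilpotent modulo the centraliser of V/W.
  nilpotentAction : ∀ {V W M} → NormalSubgroup V → NormalSubgroup W → NormalSubgroup M → ∀ {c k m} →
    (∀ x → Up (Cent V W) Whole c x) → (∀ {x} → V x → Up W M k x) →
    (∀ {x} → V x → (∀ g → M g → W [ x , g ]) → Up W Whole m x) →
    ∃ λ n → ∀ {x} → V x → Up W Whole n x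
  nilpotentAction {V} {W} {M} nV nW nM {c} {k} {m} central unipotent fixed =
    let n , bounded = induct k in n , λ x∈ → bounded x∈ (unipotent x∈)
    where
    module V = NormalSubgroup nV
    module W = NormalSubgroup nW
    module M = NormalSubgroup nM
    T : ℕ → Pd
    T = Up W Whole
    module T i = NormalSubgroup (Up-normal nW whole-normal i)
    C : ℕ → Pd
    C = Up (Cent V W) Whole

    module C i = NormalSubgroup (Up-normal (cent-normal nV nW) whole-normal i)

    T-pred : ∀ i {x y} → T i x → T (pred i) [ x , y ]
    T-pred i {x} u = Up-pred nW whole-normal i {x} tt u

    -- Here r counts the commutators with Γ already taken. The smaller j, the closer g is to
    -- centralising V/W and the lower [x, g] lies; truncated subtraction stops at `T 0`, which is W.
    Φ : ℕ → ℕ → Carrier → Set _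
    Φ n r x = ∀ j g → M g → C j g → T (n + j ∸ r) [ x , g ]

    Φ-step : ∀ n r {x} f → V x → Φ n r x → Φ n (suc r) [ x , f ]
    Φ-step n r {x} f x∈ φ zero g _ u = Up-≤ nW whole-normal (z≤n {n + 0 ∸ suc r})
      (comm-sym W.isSubgroup (u _ (V.commˡ f x∈)))
    -- In the first Hall-Witt term [f⁻¹, g⁻¹] has dropped to `C j`; in the second the outer
    -- commutator with f⁻¹ lowers the level of T by one. Both land in the same T.
    Φ-step n r {x} f x∈ φ (suc j) g g∈ u =
      T.hallWitt i x f g
        (comm-sym (T.isSubgroup i) (≡.subst (λ i → T i [ x , [ f ⁻¹ , g ⁻¹ ] ])
          (≡.cong (_∸ suc r) (≡.sym (ℕ.+-suc n j)))
          (φ j [ f ⁻¹ , g ⁻¹ ] (M.commʳ (f ⁻¹) (M.⁻¹-closed g∈))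
            (comm-sym (C.isSubgroup j) (C.⁻¹-closed (suc j) {g} u (f ⁻¹) tt)))))
        (≡.subst (λ i → T i [ [ g , x ⁻¹ ] , f ⁻¹ ]) (ℕ.pred[m∸n]≡m∸[1+n] (n + suc j) r)
          (T-pred (n + suc j ∸ r) {[ g , x ⁻¹ ]}
            (T.resp i′ (solve 2 (λ x g → x ⊕ ⟪ x , g ⟫ ⊕ ⊖ x ⊜ ⟪ g , ⊖ x ⟫) refl x g)
              (T.isNormal i′ x (φ (suc j) g g∈ u)))))
      where i = n + suc j ∸ suc r
            i′ = n + suc j ∸ r

    climb : ∀ n s r {x} → r + s ≡ n + c → V x → Φ n r x → T (s + m) x
    -- Now r = n + c, and `C c` is everything, so all of M centralises x modulo W.
    climb n zero r {x} eq x∈ φ = fixed x∈ λ g g∈ → ≡.subst (λ i → T i [ x , g ])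
      (ℕ.m≤n⇒m∸n≡0 (ℕ.≤-reflexive (≡.trans (≡.sym eq) (ℕ.+-identityʳ r)))) (φ c g g∈ (central g))
    climb n (suc s) r eq x∈ φ f _ =
      climb n s (suc r) (≡.trans (≡.sym (ℕ.+-suc r s)) eq) (V.commˡ f x∈) (Φ-step n r f x∈ φ)

    induct : ∀ j → ∃ λ n → ∀ {x} → V x → Up W M j x → T n x
    induct zero = 0 , λ _ u → u
    induct (suc j) with induct j
    ... | n , bounded = n + c + m , λ {x} x∈ u → climb n (n + c) 0 ≡.refl x∈
      λ j g g∈ _ → Up-≤ nW whole-normal (ℕ.m≤m+n n j) {[ x , g ]} (bounded (V.commˡ g x∈) (u g g∈))

  -- Action on the hypercentre and a nilpotency criterion.

  Z-pred : ∀ i {x} y → Z i x → Z (pred i) [ x , y ]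
  Z-pred i {x} y u = Up-pred trivial-normal whole-normal i {x} tt u

  Z-≤ : ∀ {i j} → i ≤ j → ∀ {x} → Z i x → Z j x
  Z-≤ = Up-≤ trivial-normal whole-normal

  -- If x shifts the upper central series down by r, then [x, f] shifts it by r + 1, by Hall-Witt.
  -- After s commutators `Z s` is centralised; thus Γ modulo the centraliser of `Z s` is nilpotent.
  whole-Up-cent-Z : ∀ s x → Up (Cent (Z s) Trivial) Whole s x
  whole-Up-cent-Z s x = climb s 0 (ℕ.+-identityʳ s) (λ j z u → NormalSubgroup.commˡ (Z-normal j) {z} x u)
    where
    A : ℕ → Pd
    A r x = ∀ j z → Z j z → Z (j ∸ r) [ z , x ]

    A-step : ∀ r {x} f → A r x → A (suc r) [ x , f ]
    A-step r {x} f u j z z∈ = comm-sym (NormalSubgroup.isSubgroup (Z-normal i)) (NormalSubgroup.hallWitt (Z-normal i) x f z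
      (≡.subst (λ i → Z i [ [ f ⁻¹ , z ⁻¹ ] , x ]) (pred-∸ j r)
        (u (pred j) [ f ⁻¹ , z ⁻¹ ] (comm-sym (NormalSubgroup.isSubgroup (Z-normal (pred j)))
          (Z-pred j (f ⁻¹) (NormalSubgroup.⁻¹-closed (Z-normal j) {z} z∈)))))
      (≡.subst (λ i → Z i [ [ z , x ⁻¹ ] , f ⁻¹ ]) (ℕ.pred[m∸n]≡m∸[1+n] j r)
        (Z-pred (j ∸ r) {[ z , x ⁻¹ ]} (f ⁻¹) (NormalSubgroup.resp (Z-normal (j ∸ r))
          (solve 2 (λ z x → x ⊕ ⊖ ⟪ z , x ⟫ ⊕ ⊖ x ⊜ ⟪ z , ⊖ x ⟫) refl z x)
          (NormalSubgroup.isNormal (Z-normal (j ∸ r)) x (NormalSubgroup.⁻¹-closed (Z-normal (j ∸ r)) {[ z , x ]} (u j z z∈)))))))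
      where
      i = j ∸ suc r
      pred-∸ : ∀ j r → pred j ∸ r ≡ j ∸ suc r
      pred-∸ zero r = ℕ.0∸n≡0 r
      pred-∸ (suc j) r = ≡.refl

    climb : ∀ i r → i + r ≡ s → ∀ {x} → A r x → Up (Cent (Z s) Trivial) Whole i x
    climb zero r ≡.refl {x} u z z∈ = comm-sym (NormalSubgroup.isSubgroup trivial-normal)
      (≡.subst (λ i → Z i [ z , x ]) (ℕ.n∸n≡0 s) (u s z z∈))
    climb (suc i) r eq u f _ = climb i (suc r) (≡.trans (ℕ.+-suc i r) eq) (A-step r f u)

  Cᵍ : Carrier → Pd
  Cᵍ x g = Trivial [ g , x ]

  -- To be supplied by the chain condition, through the definable approximations of `Ladder`.
  CentralisersInHypercentre : Set (a ⊔ lsuc (a ⊔ b ⊔ p))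
  CentralisersInHypercentre = ∀ s → Σ Pd λ M → NormalSubgroup M × Nilpotent M ×
    ∃ λ t → ∀ {x} → (∀ g → M g → Z s [ x , g ]) → Z t x

  private module _ (cents : CentralisersInHypercentre) where

    -- An instance of `nilpotentAction` modulo `Z s`: M acts nilpotently since it is nilpotent and
    -- [V, M] ≤ M, and whatever it centralises modulo `Z s` already lies in `Z t`.
    absorb : ∀ {V} s → NormalSubgroup V → ∀ c → (∀ x → Up (Cent V (Z s)) Whole c x) →
      ∃ λ n → ∀ {x} → V x → Z n x
    absorb {V} s nV c central with cents s
    ... | M , nM , nil , t , fixed with nilpotentAction nV (Z-normal s) nM {c} {suc (proj₁ nil)} {t} central
          (λ {x} _ g g∈ → nilpotent⇒Up (Z-normal s) nil (NormalSubgroup.commʳ nM x {g} g∈))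
          (λ {x} _ u → Up-resp-⊆ (Z-≤ (z≤n {s})) (λ u → u) t {x} (fixed u))
    ... | n , bounded = n + s , λ x∈ → Up-+ s n (bounded x∈)

    whole-from-cent : ∀ s → Nilpotent (Cent (Z s) Trivial) → ∃ λ n → ∀ x → Z n x
    whole-from-cent s (k , nil) with induct k
      where
      P = Cent (Z s) Trivial
      nP : NormalSubgroup P
      nP = cent-normal (Z-normal s) trivial-normal
      induct : ∀ i → ∃ λ n → ∀ {x} → P x → Up Trivial P i x → Z n x
      induct zero = 0 , λ _ u → u
      induct (suc i) with induct i
      -- P centralises this V modulo `Z n`, so Γ acts on V modulo `Z n` through Γ/P, which is
      -- nilpotent.
      ... | n , bounded with absorb {V = P ∩ Up Trivial P (suc i)} n
                               (∩-normal nP (Up-normal trivial-normal nP (suc i))) s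
                               (λ x → Up-resp-⊆ {W = P}
                                  (λ {y} y∈ v (v∈ , w) → comm-sym (NormalSubgroup.isSubgroup (Z-normal n))
                                    (bounded (NormalSubgroup.commˡ nP y v∈) (w y y∈)))
                                  (λ u → u) s (whole-Up-cent-Z s x))
      ... | n′ , bounded′ = n′ , λ x∈ u → bounded′ (x∈ , u)
    ... | n , bounded = s + n , λ x → Up-+ n s (Up-resp-⊆ (λ u → bounded u (nil u)) (λ u → u) s (whole-Up-cent-Z s x))

    -- As `Z t` ≤ `Z n`, everything that centralises M modulo `Z n` lies in `Z n`. Climbing the
    -- upper central series of M puts M itself into `Z n`, and then every x centralises M modulo
    -- `Z n`.
    whole-from-hypercentre : ∀ n → (∀ s {x} → Z s x → Z n x) → ∀ x → Z n x
    whole-from-hypercentre n bounded x with cents n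
    ... | M , nM , (k , nil) , t , fixed = closed λ g g∈ → NormalSubgroup.commʳ (Z-normal n) x {g} (M⊆Z k g∈ (nil g∈))
      where
      closed : ∀ {x} → (∀ g → M g → Z n [ x , g ]) → Z n x
      closed u = bounded t (fixed u)
      M⊆Z : ∀ i {y} → M y → Up Trivial M i y → Z n y
      M⊆Z zero y∈ u = Z-≤ (z≤n {n}) u
      M⊆Z (suc i) y∈ u = closed λ g g∈ → M⊆Z i (NormalSubgroup.commˡ nM g y∈) (u g g∈)

  nilpotent-criterion : LocallyNilpotent → CentralisersInHypercentre → ∀ d →
    (∀ x → Nilpotent (Cᵍ x) ⊎ IndexBelow d (Cᵍ x) Whole) → ∃ λ n → ∀ x → Z n x
  nilpotent-criterion locNil cents d alternative with em {∃ λ s → Σ Carrier λ x → Z s x × Nilpotent (Cᵍ x)}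
  -- As x ∈ `Z s`, the centraliser of `Z s` is contained in the nilpotent group `Cᵍ x`.
  ... | yes (s , x , x∈ , k , nil) = whole-from-cent cents s
          (k , λ u → Up-resp-⊆ (λ u → u) (λ {g} u → u x x∈) k (nil (u x x∈)))
  -- No hypercentral element has a nilpotent centraliser, so `alternative` bounds the index for all
  -- of them, and the union of all `Z s` can be absorbed.
  ... | no none with boundedOrbits⇒Up locNil {V = λ x → ∃ λ s → Z s x} trivial-normal bounded
    where
    bounded : ∀ x → (∃ λ s → Z s x) → IndexBelow d (Cᵍ x) Whole
    bounded x (s , x∈) with alternative x
    ... | inj₁ nil = ⊥-elim (none (s , x , x∈ , nil))
    ... | inj₂ small = small
  ... | c , central with absorb cents {V = λ x → ∃ λ s → Z s x} 0 hypercentre-normal c central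
    where
    hypercentre-normal : NormalSubgroup (λ x → ∃ λ s → Z s x)
    hypercentre-normal = record
      { isSubgroup = record
        { resp = λ eq (s , u) → s , NormalSubgroup.resp (Z-normal s) eq u
        ; ε∈ = 0 , lift refl
        ; ∙-closed = λ {x} {y} (s , u) (t , v) → s + t , NormalSubgroup.∙-closed (Z-normal (s + t))
            (Z-≤ (ℕ.m≤m+n s t) {x} u) (Z-≤ (ℕ.m≤n+m t s) {y} v)
        ; ⁻¹-closed = λ {x} (s , u) → s , NormalSubgroup.⁻¹-closed (Z-normal s) {x} u
        }
      ; isNormal = λ g {x} (s , u) → s , NormalSubgroup.isNormal (Z-normal s) g {x} u
      }
  ... | n , bounded = n , whole-from-hypercentre cents n λ s u → bounded (s , u)

  -- Products of nilpotent normal subgroups.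

  -- N₁ centralises the sections of its own upper central series, so N₁N₂ acts on them through N₂.
  module _ {N₁ N₂ S : Pd} (nN₁ : NormalSubgroup N₁) (nS : NormalSubgroup S)
    (decompose : ∀ {s} → S s → Σ Carrier λ x → Σ Carrier λ y → N₁ x × N₂ y × s ≈ x ∙ y)
    (nil₁ : Nilpotent N₁) (unipotent₂ : ∃ λ l → ∀ x → Up Trivial N₂ l x) where

    factor-Up : ∃ λ n → ∀ {x} → N₁ x → Up Trivial S n x
    factor-Up = let n , bounded = induct (proj₁ nil₁) in n , λ x∈ → bounded x∈ (proj₂ nil₁ x∈)
      where
      l = proj₁ unipotent₂
      induct : ∀ i → ∃ λ n → ∀ {x} → N₁ x → Up Trivial N₁ i x → Up Trivial S n x
      induct zero = 0 , λ _ u → u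
      induct (suc i) with induct i
      ... | n , bounded = l + n , λ {x} x∈ u → Up-+ n l (extend l x∈ u
              (Up-resp-⊆ (Up-≤ trivial-normal nS (z≤n {n})) (λ u → u) l (proj₂ unipotent₂ x)))
        where
        W = Up Trivial S n
        nW : NormalSubgroup W
        nW = Up-normal trivial-normal nS n
        -- For s = yz, [x, yz] is [x, z] times a conjugate of [x, y]. The latter is in W by
        -- induction on i, so only commutators with N₂ count.
        extend : ∀ j {x} → N₁ x → Up Trivial N₁ (suc i) x → Up W N₂ j x → Up W S j x
        extend zero x∈ u v = v
        extend (suc j) {x} x∈ u v s s∈ with decompose s∈
        ... | y , z , y∈ , z∈ , s≈yz = U.resp
          (trans (solve 3 (λ x y z → ⟪ x , z ⟫ ⊕ (⊖ z ⊕ ⟪ x , y ⟫ ⊕ z) ⊜ ⟪ x , y ⊕ z ⟫) refl x y z)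
                 (comm-cong refl (sym s≈yz)))
          (U.∙-closed (extend j (NormalSubgroup.commˡ nN₁ z x∈) (NormalSubgroup.commˡ (Up-normal trivial-normal nN₁ (suc i)) {x} z u) (v z z∈))
            (U.conj z (Up-≤ nW nS (z≤n {j}) (bounded (NormalSubgroup.commˡ nN₁ y x∈) (u y y∈)))))
          where module U = NormalSubgroup (Up-normal nW nS j)

  _·_ : Pd → Pd → Pd
  (N₁ · N₂) s = Σ Carrier λ x → Σ Carrier λ y → N₁ x × N₂ y × s ≈ x ∙ y

  module _ {N₁ N₂ : Pd} (nN₁ : NormalSubgroup N₁) (nN₂ : NormalSubgroup N₂) where
    private
      module N₁ = NormalSubgroup nN₁
      module N₂ = NormalSubgroup nN₂

    ·-normal : NormalSubgroup (N₁ · N₂)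
    ·-normal = record
      { isSubgroup = record
        { resp = λ { eq (x , y , x∈ , y∈ , s≈) → x , y , x∈ , y∈ , trans (sym eq) s≈ }
        ; ε∈ = ε , ε , N₁.ε∈ , N₂.ε∈ , sym (identityˡ ε)
        ; ∙-closed = λ { (x , y , x∈ , y∈ , s≈) (x′ , y′ , x′∈ , y′∈ , s′≈) →
            x ∙ (y ∙ x′ ∙ y ⁻¹) , y ∙ y′ , N₁.∙-closed x∈ (N₁.isNormal y x′∈) , N₂.∙-closed y∈ y′∈ ,
            trans (∙-cong s≈ s′≈)
              (solve 4 (λ x y x′ y′ → (x ⊕ y) ⊕ (x′ ⊕ y′) ⊜ (x ⊕ (y ⊕ x′ ⊕ ⊖ y)) ⊕ (y ⊕ y′)) refl x y x′ y′) }
        ; ⁻¹-closed = λ { (x , y , x∈ , y∈ , s≈) →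
            x ⁻¹ , x ∙ y ⁻¹ ∙ x ⁻¹ , N₁.⁻¹-closed x∈ , N₂.isNormal x (N₂.⁻¹-closed y∈) ,
            trans (⁻¹-cong s≈) (solve 2 (λ x y → ⊖ (x ⊕ y) ⊜ ⊖ x ⊕ (x ⊕ ⊖ y ⊕ ⊖ x)) refl x y) }
        }
      ; isNormal = λ { g (x , y , x∈ , y∈ , s≈) →
          g ∙ x ∙ g ⁻¹ , g ∙ y ∙ g ⁻¹ , N₁.isNormal g x∈ , N₂.isNormal g y∈ ,
          trans (∙-congʳ (∙-congˡ s≈)) (solve 3 (λ g x y → g ⊕ (x ⊕ y) ⊕ ⊖ g ⊜ (g ⊕ x ⊕ ⊖ g) ⊕ (g ⊕ y ⊕ ⊖ g)) refl g x y) }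
      }

    -- Fitting's theorem: by `factor-Up` each factor lies in a term of the upper central series of
    -- the product. For the second factor, xy is rewritten as (xyx⁻¹)x.
    fitting : Nilpotent N₁ → Nilpotent N₂ → Nilpotent (N₁ · N₂)
    fitting nil₁ nil₂ =
      let n₁ , bounded₁ = factor-Up {N₂ = N₂} nN₁ ·-normal (λ u → u) nil₁ (unipotent nN₂ nil₂)
          n₂ , bounded₂ = factor-Up {N₂ = N₁} nN₂ ·-normal
            (λ { (x , y , x∈ , y∈ , s≈) → x ∙ y ∙ x ⁻¹ , x , N₂.isNormal x y∈ , x∈ ,
               trans s≈ (solve 2 (λ x y → x ⊕ y ⊜ (x ⊕ y ⊕ ⊖ x) ⊕ x) refl x y) }) nil₂ (unipotent nN₁ nil₁)
          module U = NormalSubgroup (Up-normal trivial-normal ·-normal (n₁ + n₂))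
      in n₁ + n₂ , λ { (x , y , x∈ , y∈ , s≈) → U.resp (sym s≈) (U.∙-closed
           (Up-≤ trivial-normal ·-normal (ℕ.m≤m+n n₁ n₂) (bounded₁ x∈))
           (Up-≤ trivial-normal ·-normal (ℕ.m≤n+m n₂ n₁) (bounded₂ y∈))) }
      where
      unipotent : ∀ {N} → NormalSubgroup N → Nilpotent N → ∃ λ l → ∀ x → Up Trivial N l x
      -- The extra step is the first commutator, which brings any x into N.
      unipotent nN (k , nil) = suc k , λ x y y∈ → nil (NormalSubgroup.commʳ nN x y∈)

-- Subgroups as groups in their own right.

module Restriction {a b} (G : Group a b) {p} (D : GroupNotions.Pred G p) (subD : GroupNotions.IsSubgroup G D) where
  private module G = Basics G
  private module D = G.IsSubgroup subD

  group : Group (a ⊔ p) b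
  group = record
    { Carrier = Σ G.Carrier D
    ; _≈_ = λ x y → proj₁ x G.≈ proj₁ y
    ; _∙_ = λ (x , x∈) (y , y∈) → x G.∙ y , D.∙-closed x∈ y∈
    ; ε = G.ε , D.ε∈
    ; _⁻¹ = λ (x , x∈) → x G.⁻¹ , D.⁻¹-closed x∈
    ; isGroup = record
      { isMonoid = record
        { isSemigroup = record
          { isMagma = record
            { isEquivalence = record { refl = G.refl ; sym = G.sym ; trans = G.trans }
            ; ∙-cong = G.∙-cong }
          ; assoc = λ x y z → G.assoc _ _ _ }
        ; identity = (λ x → G.identityˡ _) , (λ x → G.identityʳ _) }
      ; inverse = (λ x → G.inverseˡ _) , (λ x → G.inverseʳ _)
      ; ⁻¹-cong = G.⁻¹-cong }
    }

  private module Γ = Basics group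

  indexBelow-restrict : ∀ {p q p′ q′} {A : G.Pred p} {B : G.Pred q} {A′ : Γ.Pred p′} {B′ : Γ.Pred q′} {d} →
    Γ.IsSubgroup B′ → (∀ {x} → B′ x → B (proj₁ x)) → (∀ {x} → B′ x → A (proj₁ x) → A′ x) →
    G.IndexBelow d A B → Γ.IndexBelow d A′ B′
  indexBelow-restrict sub B′⊆B A⊆A′ (G.below small) = Γ.below λ (x , x∈ , distinct) → small
    ((λ i → proj₁ (x i)) , (λ i → B′⊆B (x∈ i)) ,
     λ i j i≢j u → distinct i j i≢j (A⊆A′ (∙-closed (⁻¹-closed (x∈ i)) (x∈ j)) u))
    where open Γ.IsSubgroup sub

  restrict-normal : ∀ {q r} {N : G.Pred q} → G.IsSubgroup N → (∀ {g x} → D g → N x → N (g G.∙ x G.∙ g G.⁻¹)) →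
    Γ.NormalSubgroup (λ x → Lift r (N (proj₁ x)))
  restrict-normal sub norm = record
    { isSubgroup = record
      { resp = λ eq (lift u) → lift (N.resp eq u)
      ; ε∈ = lift N.ε∈
      ; ∙-closed = λ (lift u) (lift v) → lift (N.∙-closed u v)
      ; ⁻¹-closed = λ (lift u) → lift (N.⁻¹-closed u)
      }
    ; isNormal = λ (g , g∈) (lift u) → lift (norm g∈ u)
    }
    where module N = G.IsSubgroup sub

-- Closure properties of definable sets.

module Definability {L : Language} {c ℓ : Level} (M : Structure L c ℓ) where
  open Structure M using (group; funcᴵ-cong; relᴵ-cong)
  open Basics group
  open WordSolver group using (solve; _⊜_; _⊕_; ⊖_; 𝕖; ⟪_,_⟫)
  open Syntax L
  open Semantics M
  open Equivalence using (to; from)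

  extendᵣ : ∀ {m n} → (Fin m → Fin n) → Fin (suc m) → Fin (suc n)
  extendᵣ σ zero    = zero
  extendᵣ σ (suc i) = suc (σ i)

  renameₜ : ∀ {m n} → (Fin m → Fin n) → Term m → Term n
  renameₜ σ (var i)     = var (σ i)
  renameₜ σ one         = one
  renameₜ σ (s · t)     = renameₜ σ s · renameₜ σ t
  renameₜ σ (inv t)     = inv (renameₜ σ t)
  renameₜ σ (func f ts) = func f (λ i → renameₜ σ (ts i))

  rename : ∀ {m n} → (Fin m → Fin n) → Formula m → Formula n
  rename σ (s ≐ t)    = renameₜ σ s ≐ renameₜ σ t
  rename σ (rel r ts) = rel r (λ i → renameₜ σ (ts i))
  rename σ ⊥ᶠ         = ⊥ᶠ
  rename σ (φ ∧ᶠ ψ)   = rename σ φ ∧ᶠ rename σ ψ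
  rename σ (φ ∨ᶠ ψ)   = rename σ φ ∨ᶠ rename σ ψ
  rename σ (φ ⇒ᶠ ψ)   = rename σ φ ⇒ᶠ rename σ ψ
  rename σ (∀ᶠ φ)     = ∀ᶠ (rename (extendᵣ σ) φ)
  rename σ (∃ᶠ φ)     = ∃ᶠ (rename (extendᵣ σ) φ)

  Agree : ∀ {m n} → (Fin m → Fin n) → (Fin m → Carrier) → (Fin n → Carrier) → Set ℓ
  Agree σ ρ ρ′ = ∀ i → ρ i ≈ ρ′ (σ i)

  renameₜ-correct : ∀ {m n} (σ : Fin m → Fin n) t {ρ ρ′} → Agree σ ρ ρ′ → ⟦ t ⟧ₜ ρ ≈ ⟦ renameₜ σ t ⟧ₜ ρ′
  renameₜ-correct σ (var i) agree     = agree i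
  renameₜ-correct σ one agree         = refl
  renameₜ-correct σ (s · t) agree     = ∙-cong (renameₜ-correct σ s agree) (renameₜ-correct σ t agree)
  renameₜ-correct σ (inv t) agree     = ⁻¹-cong (renameₜ-correct σ t agree)
  renameₜ-correct σ (func f ts) agree = funcᴵ-cong f (λ i → renameₜ-correct σ (ts i) agree)

  agree-extend : ∀ {m n} {σ : Fin m → Fin n} {ρ ρ′} → Agree σ ρ ρ′ → ∀ x → Agree (extendᵣ σ) (extend x ρ) (extend x ρ′)
  agree-extend agree x zero    = refl
  agree-extend agree x (suc i) = agree i

  -- Environments are compared pointwise up to ≈, in place of function extensionality. With σ the
  -- identity this is the invariance of formulas under ≈.
  rename-correct : ∀ {m n} (σ : Fin m → Fin n) φ {ρ ρ′} → Agree σ ρ ρ′ → ⟦ φ ⟧ ρ ⇔ ⟦ rename σ φ ⟧ ρ′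
  rename-correct σ (s ≐ t) agree = mk⇔
    (λ (lift eq) → lift (trans (sym (renameₜ-correct σ s agree)) (trans eq (renameₜ-correct σ t agree))))
    (λ (lift eq) → lift (trans (renameₜ-correct σ s agree) (trans eq (sym (renameₜ-correct σ t agree)))))
  rename-correct σ (rel r ts) agree = mk⇔
    (λ (lift u) → lift (relᴵ-cong r (λ i → renameₜ-correct σ (ts i) agree) u))
    (λ (lift u) → lift (relᴵ-cong r (λ i → sym (renameₜ-correct σ (ts i) agree)) u))
  rename-correct σ ⊥ᶠ agree = mk⇔ (λ u → u) (λ u → u)
  rename-correct σ (φ ∧ᶠ ψ) agree = let f = rename-correct σ φ agree ; g = rename-correct σ ψ agree in
    mk⇔ (λ (u , v) → to f u , to g v) (λ (u , v) → from f u , from g v)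
  rename-correct σ (φ ∨ᶠ ψ) agree = let f = rename-correct σ φ agree ; g = rename-correct σ ψ agree in
    mk⇔ [ (λ u → inj₁ (to f u)) , (λ v → inj₂ (to g v)) ]′ [ (λ u → inj₁ (from f u)) , (λ v → inj₂ (from g v)) ]′
  rename-correct σ (φ ⇒ᶠ ψ) agree = let f = rename-correct σ φ agree ; g = rename-correct σ ψ agree in
    mk⇔ (λ h u → to g (h (from f u))) (λ h u → from g (h (to f u)))
  rename-correct σ (∀ᶠ φ) agree = mk⇔
    (λ h x → to (rename-correct (extendᵣ σ) φ (agree-extend agree x)) (h x))
    (λ h x → from (rename-correct (extendᵣ σ) φ (agree-extend agree x)) (h x))
  rename-correct σ (∃ᶠ φ) agree = mk⇔
    (λ (x , u) → x , to (rename-correct (extendᵣ σ) φ (agree-extend agree x)) u)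
    (λ (x , u) → x , from (rename-correct (extendᵣ σ) φ (agree-extend agree x)) u)

  Env : ℕ → Set c
  Env n = Fin n → Carrier

  value : ∀ {n} → Env n → Fin n ⊎ Carrier → Carrier
  value ρ = [ ρ , (λ x → x) ]′

  -- The variables of the formula are assigned to variables of the context or to parameters.
  record Definable {n} (P : Env n → Set (c ⊔ ℓ)) : Set (c ⊔ ℓ) where
    field
      {size}  : ℕ
      formula : Formula size
      assign  : Fin size → Fin n ⊎ Carrier
      correct : ∀ ρ → P ρ ⇔ ⟦ formula ⟧ (λ i → value ρ (assign i))

  module _ {n} {P Q : Env n → Set (c ⊔ ℓ)} where

    iffᴰ : (∀ ρ → P ρ ⇔ Q ρ) → Definable P → Definable Q
    iffᴰ P⇔Q D = record
      { formula = formula ; assign = assign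
      ; correct = λ ρ → mk⇔ (λ u → to (correct ρ) (from (P⇔Q ρ) u)) (λ u → to (P⇔Q ρ) (from (correct ρ) u)) }
      where open Definable D

    module _ (D : Definable P) (E : Definable Q) where
      private
        module D = Definable D
        module E = Definable E
        assign : Fin (D.size + E.size) → Fin n ⊎ Carrier
        assign i = [ D.assign , E.assign ]′ (Fin.splitAt D.size i)
        φ = rename (Fin._↑ˡ E.size) D.formula
        ψ = rename (D.size Fin.↑ʳ_) E.formula
        f : ∀ ρ → P ρ ⇔ ⟦ φ ⟧ (λ i → value ρ (assign i))
        f ρ = let r = rename-correct (Fin._↑ˡ E.size) D.formula (λ i →
                        reflexive (≡.cong (λ s → value ρ ([ D.assign , E.assign ]′ s)) (≡.sym (Fin.splitAt-↑ˡ D.size i E.size))))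
              in mk⇔ (λ u → to r (to (D.correct ρ) u)) (λ u → from (D.correct ρ) (from r u))
        g : ∀ ρ → Q ρ ⇔ ⟦ ψ ⟧ (λ i → value ρ (assign i))
        g ρ = let r = rename-correct (D.size Fin.↑ʳ_) E.formula (λ i →
                        reflexive (≡.cong (λ s → value ρ ([ D.assign , E.assign ]′ s)) (≡.sym (Fin.splitAt-↑ʳ D.size E.size i))))
              in mk⇔ (λ u → to r (to (E.correct ρ) u)) (λ u → from (E.correct ρ) (from r u))

      andᴰ : Definable (λ ρ → P ρ × Q ρ)
      andᴰ = record { formula = φ ∧ᶠ ψ ; assign = assign ; correct = λ ρ →
        mk⇔ (λ (u , v) → to (f ρ) u , to (g ρ) v) (λ (u , v) → from (f ρ) u , from (g ρ) v) }

      orᴰ : Definable (λ ρ → P ρ ⊎ Q ρ)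
      orᴰ = record { formula = φ ∨ᶠ ψ ; assign = assign ; correct = λ ρ →
        mk⇔ [ (λ u → inj₁ (to (f ρ) u)) , (λ u → inj₂ (to (g ρ) u)) ]′ [ (λ u → inj₁ (from (f ρ) u)) , (λ u → inj₂ (from (g ρ) u)) ]′ }

      impᴰ : Definable (λ ρ → P ρ → Q ρ)
      impᴰ = record { formula = φ ⇒ᶠ ψ ; assign = assign ; correct = λ ρ →
        mk⇔ (λ h u → to (g ρ) (h (from (f ρ) u))) (λ h u → from (g ρ) (h (to (f ρ) u))) }

  falseᴰ : ∀ {n} → Definable {n} (λ _ → Lift (c ⊔ ℓ) ⊥)
  falseᴰ = record { formula = ⊥ᶠ {0} ; assign = λ () ; correct = λ ρ → mk⇔ (λ u → u) (λ u → u) }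

  notᴰ : ∀ {n} {P : Env n → Set (c ⊔ ℓ)} → Definable P → Definable (λ ρ → ¬ P ρ)
  notᴰ D = iffᴰ (λ ρ → mk⇔ (λ h u → lower (h u)) (λ h u → lift (h u))) (impᴰ D falseᴰ)

  trueᴰ : ∀ {n} → Definable {n} (λ _ → ⊤)
  trueᴰ = iffᴰ (λ ρ → mk⇔ (λ _ → tt) (λ _ u → u)) (impᴰ falseᴰ falseᴰ)

  eqᴰ : ∀ {n} (s t : Term n) → Definable (λ ρ → Lift c (⟦ s ⟧ₜ ρ ≈ ⟦ t ⟧ₜ ρ))
  eqᴰ s t = record { formula = s ≐ t ; assign = inj₁ ; correct = λ ρ → mk⇔ (λ u → u) (λ u → u) }

  substᴰ : ∀ {n k} {P : Env n → Set (c ⊔ ℓ)} (σ : Fin n → Fin k ⊎ Carrier) (e : Env k → Env n) →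
    (∀ ρ i → e ρ i ≈ value ρ (σ i)) → Definable P → Definable (λ ρ → P (e ρ))
  substᴰ {n} {k} {P} σ e e≈σ D = record { formula = rename (λ i → i) formula ; assign = λ i → bind (assign i)
    ; correct = λ ρ → let r = rename-correct (λ i → i) formula (λ i → agree ρ (assign i))
                      in mk⇔ (λ u → to r (to (correct (e ρ)) u)) (λ u → from (correct (e ρ)) (from r u)) }
    where
    open Definable D
    bind : Fin n ⊎ Carrier → Fin k ⊎ Carrier
    bind = [ σ , inj₂ ]′
    agree : ∀ ρ v → value (e ρ) v ≈ value ρ (bind v)
    agree ρ (inj₁ i) = e≈σ ρ i
    agree ρ (inj₂ x) = refl

  Definable-resp : ∀ {n} {P : Env n → Set (c ⊔ ℓ)} → Definable P → ∀ {ρ ρ′} → (∀ i → ρ i ≈ ρ′ i) → P ρ → P ρ′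
  Definable-resp D {ρ} {ρ′} ρ≈ρ′ u = from (correct ρ′) (from (rename-correct (λ i → i) formula {ρ′ = env ρ′} (λ _ → refl))
    (to (rename-correct (λ i → i) formula (λ i → agree (assign i))) (to (correct ρ) u)))
    where
    open Definable D
    env : Env _ → Env _
    env ρ i = value ρ (assign i)
    agree : ∀ v → value ρ v ≈ value ρ′ v
    agree (inj₁ i) = ρ≈ρ′ i
    agree (inj₂ x) = refl

  module _ {n} {P : Env (suc n) → Set (c ⊔ ℓ)} (D : Definable P) where
    private
      open Definable D
      bound : Fin size → Fin (suc n) ⊎ Carrier → Fin (suc size)
      bound i (inj₁ zero)    = zero
      bound i (inj₁ (suc _)) = suc i
      bound i (inj₂ _)       = suc i
      -- A variable assigned to the bound one becomes junk (ε).
      free : Fin (suc n) ⊎ Carrier → Fin n ⊎ Carrier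
      free (inj₁ zero)    = inj₂ ε
      free (inj₁ (suc j)) = inj₁ j
      free (inj₂ x)       = inj₂ x
      body : Formula (suc size)
      body = rename (λ i → bound i (assign i)) formula
      agree : ∀ ρ x i v → assign i ≡ v → value (extend x ρ) v ≈ extend x (λ i → value ρ (free (assign i))) (bound i v)
      agree ρ x i (inj₁ zero) eq = refl
      agree ρ x i (inj₁ (suc j)) eq rewrite eq = refl
      agree ρ x i (inj₂ y) eq rewrite eq = refl
      body-correct : ∀ ρ x → P (extend x ρ) ⇔ ⟦ body ⟧ (extend x (λ i → value ρ (free (assign i))))
      body-correct ρ x = let r = rename-correct (λ i → bound i (assign i)) formula (λ i → agree ρ x i (assign i) ≡.refl)
        in mk⇔ (λ u → to r (to (correct (extend x ρ)) u)) (λ u → from (correct (extend x ρ)) (from r u))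

    allᴰ : Definable (λ ρ → ∀ x → P (extend x ρ))
    allᴰ = record { formula = ∀ᶠ body ; assign = λ i → free (assign i) ; correct = λ ρ →
      mk⇔ (λ h x → to (body-correct ρ x) (h x)) (λ h x → from (body-correct ρ x) (h x)) }

    exᴰ : Definable (λ ρ → Σ Carrier λ x → P (extend x ρ))
    exᴰ = record { formula = ∃ᶠ body ; assign = λ i → free (assign i) ; correct = λ ρ →
      mk⇔ (λ (x , u) → x , to (body-correct ρ x) u) (λ (x , u) → x , from (body-correct ρ x) u) }

  allFinᴰ : ∀ {n} k {P : Fin k → Env n → Set (c ⊔ ℓ)} → (∀ i → Definable (P i)) → Definable (λ ρ → ∀ i → P i ρ)
  allFinᴰ zero D = iffᴰ (λ ρ → mk⇔ (λ _ ()) (λ _ → tt)) trueᴰ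
  allFinᴰ (suc k) D = iffᴰ (λ ρ → mk⇔ (λ { (u , v) zero → u ; (u , v) (suc i) → v i }) (λ u → u zero , λ i → u (suc i)))
    (andᴰ (D zero) (allFinᴰ k (λ i → D (suc i))))

  exFinᴰ : ∀ {n} k {P : Fin k → Env n → Set (c ⊔ ℓ)} → (∀ i → Definable (P i)) → Definable (λ ρ → Σ (Fin k) λ i → P i ρ)
  exFinᴰ zero D = iffᴰ (λ ρ → mk⇔ (λ ()) (λ ())) falseᴰ
  exFinᴰ (suc k) D = iffᴰ (λ ρ → mk⇔ (λ { (inj₁ u) → zero , u ; (inj₂ (i , u)) → suc i , u })
                                     (λ { (zero , u) → inj₁ u ; (suc i , u) → inj₂ (i , u) }))
    (orᴰ (D zero) (exFinᴰ k (λ i → D (suc i))))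

  prepend : ∀ {n} d → Env d → Env n → Env (d + n)
  prepend d x ρ i = [ x , ρ ]′ (Fin.splitAt d i)

  -- A block of d quantifiers, as needed to say in one formula that an index is at least d.
  exsᴰ : ∀ {n} d {P : Env (d + n) → Set (c ⊔ ℓ)} → Definable P → Definable (λ ρ → Σ (Env d) λ x → P (prepend d x ρ))
  exsᴰ zero D = iffᴰ (λ ρ → mk⇔ (λ u → (λ ()) , u) (λ (_ , u) → u)) D
  exsᴰ {n} (suc d) {P} D = iffᴰ {P = λ ρ → Σ (Env d) λ x → Σ Carrier λ y → P (extend y (prepend d x ρ))}
    (λ ρ → mk⇔ (λ (x , y , u) → extend y x , Definable-resp D (prepend-extend x ρ (extend y x) y refl (λ _ → refl)) u)
               (λ (x , u) → (λ i → x (suc i)) , x zero , Definable-resp D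
                  (λ i → sym (prepend-extend (λ i → x (suc i)) ρ x (x zero) refl (λ _ → refl) i)) u))
    (exsᴰ d (exᴰ D))
    where
    prepend-extend : ∀ x (ρ : Env n) x′ y → y ≈ x′ zero → (∀ i → x i ≈ x′ (suc i)) →
      ∀ i → extend y (prepend d x ρ) i ≈ prepend (suc d) x′ ρ i
    prepend-extend x ρ x′ y p q zero = p
    prepend-extend x ρ x′ y p q (suc i) with Fin.splitAt d i
    ... | inj₁ j = q j
    ... | inj₂ j = refl

  DefinablePred : Pred (c ⊔ ℓ) → Set (c ⊔ ℓ)
  DefinablePred E = Definable {1} (λ ρ → E (ρ zero))

  -- `substᴰ` inserts only variables and parameters; a term is inserted through an auxiliary x with
  -- x = t.
  memberᴰ : ∀ {n E} → DefinablePred E → (∀ {x y} → x ≈ y → E x → E y) → (t : Term n) → Definable (λ ρ → E (⟦ t ⟧ₜ ρ))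
  memberᴰ D resp t = iffᴰ
    (λ ρ → mk⇔ (λ (x , lift x≈t , u) → resp (trans x≈t (sym (renameₜ-correct suc t {ρ} {extend x ρ} (λ _ → refl)))) u)
               (λ u → ⟦ t ⟧ₜ ρ , lift (renameₜ-correct suc t {ρ} {extend (⟦ t ⟧ₜ ρ) ρ} (λ _ → refl)) , u))
    (exᴰ (andᴰ (eqᴰ (var zero) (renameₜ suc t)) (substᴰ (λ _ → inj₁ zero) (λ ρ _ → ρ zero) (λ _ _ → refl) D)))

  -- Back to the format of `IsMcTilde`, with one distinguished variable and a parameter slot for
  -- every variable of the formula.
  defined : ∀ {E} → DefinablePred E → ∃ λ m → Σ (Formula (suc m)) λ φ → Σ (Env m) λ a → ∀ x → E x ⇔ Defined M φ a x
  defined {E} D = size , rename (λ i → var′ i (assign i)) formula , (λ i → param (assign i)) , λ x →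
    let r = rename-correct (λ i → var′ i (assign i)) formula {λ i → value (λ _ → x) (assign i)} (λ i → agree x i (assign i) ≡.refl)
    in mk⇔ (λ u → to r (to (correct (λ _ → x)) u)) (λ u → from (correct (λ _ → x)) (from r u))
    where
    open Definable D
    var′ : Fin size → Fin 1 ⊎ Carrier → Fin (suc size)
    var′ i (inj₁ _) = zero
    var′ i (inj₂ _) = suc i
    param : Fin 1 ⊎ Carrier → Carrier
    -- Filler for a slot whose variable has become the distinguished one.
    param (inj₁ _) = ε
    param (inj₂ x) = x
    agree : ∀ x i v → assign i ≡ v → value (λ _ → x) v ≈ extend x (λ i → param (assign i)) (var′ i v)
    agree x i (inj₁ _) eq = refl
    agree x i (inj₂ y) eq rewrite eq = refl

-- The chain condition for definable subgroups.

module Envelope {L : Language} {c ℓ : Level} (em : ExcludedMiddle (lsuc (c ⊔ ℓ)))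
  (M : Structure L c ℓ) (mc : IsMcTilde M) where
  open Structure M using (group)
  open Definability M using (DefinablePred; Definable; iffᴰ; andᴰ; impᴰ; notᴰ; trueᴰ; eqᴰ; substᴰ; allᴰ; allFinᴰ; exFinᴰ;
    prepend; exsᴰ; memberᴰ; defined; Env)
  open Syntax L using (Term; var; one; _·_; inv)

  em₀ : ExcludedMiddle (c ⊔ ℓ)
  em₀ {P} with em {Lift (lsuc (c ⊔ ℓ)) P}
  ... | yes (lift p) = yes p
  ... | no ¬p = no λ p → ¬p (lift p)

  open FiniteIndex group ℓ em₀
  open WordSolver group using (solve; _⊜_; _⊕_; ⊖_; 𝕖; ⟪_,_⟫)
  open Equivalence using (to; from)

  record DefinableSubgroup : Set (lsuc (c ⊔ ℓ)) where
    field
      ⟨_⟩        : Pred (c ⊔ ℓ)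
      definable  : DefinablePred ⟨_⟩
      isSubgroup : IsSubgroup ⟨_⟩
    open IsSubgroup isSubgroup public
  open DefinableSubgroup using (⟨_⟩; definable; isSubgroup)

  ChainBound : Pred (c ⊔ ℓ) → Pred (c ⊔ ℓ) → Set (c ⊔ ℓ)
  ChainBound H N = Σ ℕ λ n → Σ ℕ λ d → ∀ m (gs : Fin (suc m) → Carrier) → (∀ i → H (gs i)) →
    (∀ k (k<m : k < m) → IndexAtLeast d (CentMod H N (take (suc k) (s≤s k<m) gs))
                                        (CentMod H N (take k (ℕ.m<n⇒m<1+n k<m) gs))) → m ≤ n

  abstract
    chainBound : ∀ H N → NormalizedBy ⟨ N ⟩ ⟨ H ⟩ → ChainBound ⟨ H ⟩ ⟨ N ⟩
    chainBound H N norm with defined (definable H) | defined (definable N)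
    ... | _ , φ , a , H⇔ | _ , ψ , b , N⇔
      with mc φ a ψ b (transport H⇔ (isSubgroup H)) (transport N⇔ (isSubgroup N))
             (λ h∈ x∈ → to (N⇔ _) (norm (from (H⇔ _) h∈) (from (N⇔ _) x∈)))
      where
      transport : ∀ {P Q : Pred (c ⊔ ℓ)} → (∀ x → P x ⇔ Q x) → IsSubgroup P → IsSubgroup Q
      transport P⇔Q sub = record
        { resp = λ eq u → to (P⇔Q _) (P.resp eq (from (P⇔Q _) u))
        ; ε∈ = to (P⇔Q _) P.ε∈
        ; ∙-closed = λ u v → to (P⇔Q _) (P.∙-closed (from (P⇔Q _) u) (from (P⇔Q _) v))
        ; ⁻¹-closed = λ u → to (P⇔Q _) (P.⁻¹-closed (from (P⇔Q _) u))
        }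
        where module P = IsSubgroup sub
    ... | n , d , bounded = n , d , λ m gs gs∈ large → bounded m gs (λ i → to (H⇔ _) (gs∈ i)) λ k k<m →
      let x , x∈ , distinct = large k k<m in
      x , (λ i → to (H⇔ _) (proj₁ (x∈ i)) , λ j → to (N⇔ _) (proj₂ (x∈ i) j)) ,
      λ i j i≢j (u , v) → distinct i j i≢j (from (H⇔ _) u , λ l → from (N⇔ _) (v l))

  snoc : ∀ {m} → (Fin m → Carrier) → Carrier → Fin (suc m) → Carrier
  snoc {zero}  gs g i       = g
  snoc {suc m} gs g zero    = gs zero
  snoc {suc m} gs g (suc i) = snoc (λ i → gs (suc i)) g i

  snoc-inject₁ : ∀ {m} (gs : Fin m → Carrier) g i → snoc gs g (inject₁ i) ≡ gs i
  snoc-inject₁ {suc m} gs g zero    = ≡.refl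
  snoc-inject₁ {suc m} gs g (suc i) = snoc-inject₁ (λ i → gs (suc i)) g i

  snoc-last : ∀ {m} (gs : Fin m → Carrier) g → snoc gs g (fromℕ m) ≡ g
  snoc-last {zero}  gs g = ≡.refl
  snoc-last {suc m} gs g = snoc-last (λ i → gs (suc i)) g

  snoc-All : ∀ {m p} {P : Pred p} (gs : Fin m → Carrier) {g} → (∀ i → P (gs i)) → P g → ∀ i → P (snoc gs g i)
  snoc-All {zero}  gs gs∈ g∈ i       = g∈
  snoc-All {suc m} gs gs∈ g∈ zero    = gs∈ zero
  snoc-All {suc m} {P = P} gs gs∈ g∈ (suc i) = snoc-All {P = P} (λ i → gs (suc i)) (λ i → gs∈ (suc i)) g∈ i

  module ChainInduction (H N : DefinableSubgroup) (norm : NormalizedBy ⟨ N ⟩ ⟨ H ⟩)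
    {s} (S : Pred s) (S⊆H : ∀ {x} → S x → ⟨ H ⟩ x) where

    d : ℕ
    d = proj₁ (proj₂ (chainBound H N norm))

    C : ∀ {m} → (Fin m → Carrier) → Pred (c ⊔ ℓ)
    C = CentMod ⟨ H ⟩ ⟨ N ⟩

    Chain : ∀ m → (Fin (suc m) → Carrier) → Set (c ⊔ ℓ)
    Chain m gs = ∀ k (k<m : k < m) → IndexAtLeast d (C (take (suc k) (s≤s k<m) gs)) (C (take k (ℕ.m<n⇒m<1+n k<m) gs))

    C-cong : ∀ {m} {gs hs : Fin m → Carrier} → (∀ i → gs i ≡ hs i) → ∀ {x} → C gs x → C hs x
    C-cong eq (u , v) = u , λ i → ≡.subst (λ g → ⟨ N ⟩ [ _ , g ]) (eq i) (v i)

    index-cong : ∀ {m m′} {gs hs : Fin m → Carrier} {gs′ hs′ : Fin m′ → Carrier} → (∀ i → gs i ≡ hs i) → (∀ i → gs′ i ≡ hs′ i) →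
      IndexAtLeast d (C gs) (C gs′) → IndexAtLeast d (C hs) (C hs′)
    index-cong eq eq′ (x , x∈ , distinct) =
      x , (λ i → C-cong eq′ (x∈ i)) , λ i j i≢j u → distinct i j i≢j (C-cong (λ i → ≡.sym (eq i)) u)

    C-snoc : ∀ {m} {gs : Fin m → Carrier} {g x} → C (snoc gs g) x → C gs x × ⟨ N ⟩ [ x , g ]
    C-snoc {gs = gs} {g} (u , v) = (u , λ i → ≡.subst (λ g → ⟨ N ⟩ [ _ , g ]) (snoc-inject₁ gs g i) (v (inject₁ i))) ,
      ≡.subst (λ g → ⟨ N ⟩ [ _ , g ]) (snoc-last gs g) (v (fromℕ _))

    snoc-C : ∀ {m} {gs : Fin m → Carrier} {g x} → C gs x → ⟨ N ⟩ [ x , g ] → C (snoc gs g) x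
    snoc-C {gs = gs} (u , v) w = u , snoc-All {P = λ g → ⟨ N ⟩ [ _ , g ]} gs v w

    extend-chain : ∀ {m} {gs : Fin (suc m) → Carrier} {g} → Chain m gs → IndexAtLeast d (C (snoc gs g)) (C gs) →
      Chain (suc m) (snoc gs g)
    extend-chain {m} {gs} {g} chain large k k<1+m with ℕ.m≤n⇒m<n∨m≡n (s≤s⁻¹ k<1+m)
    ... | inj₁ k<m = index-cong (old (suc k) (s≤s k<m) (s≤s k<1+m)) (old k (ℕ.m<n⇒m<1+n k<m) (ℕ.m<n⇒m<1+n k<1+m)) (chain k k<m)
      where
      old : ∀ k (p : suc k ≤ suc m) (q : suc k ≤ suc (suc m)) i → gs (inject≤ i p) ≡ snoc gs g (inject≤ i q)
      old k p q i = ≡.trans (≡.sym (snoc-inject₁ gs g (inject≤ i p))) (≡.cong (snoc gs g) (Fin.toℕ-injective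
        (≡.trans (Fin.toℕ-inject₁ _) (≡.trans (Fin.toℕ-inject≤ i p) (≡.sym (Fin.toℕ-inject≤ i q))))))
    ... | inj₂ ≡.refl = index-cong
      (λ i → ≡.cong (snoc gs g) (Fin.toℕ-injective (≡.sym (Fin.toℕ-inject≤ i (s≤s k<1+m)))))
      (λ i → ≡.trans (≡.sym (snoc-inject₁ gs g i)) (≡.cong (snoc gs g) (Fin.toℕ-injective
        (≡.trans (Fin.toℕ-inject₁ i) (≡.sym (Fin.toℕ-inject≤ i (ℕ.m<n⇒m<1+n k<1+m))))))) large

    -- Each extension of large index lengthens the chain, and no chain is longer than n. So `fuel`,
    -- which starts at n + 1, cannot run out.
    chain-induction : ∀ {q} (Q : ∀ {m} → (Fin (suc m) → Carrier) → Set q) →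
      (∀ {m} (gs : Fin (suc m) → Carrier) → (∀ i → S (gs i)) →
        (∀ g → S g → IndexAtLeast d (C (snoc gs g)) (C gs) → Q (snoc gs g)) → Q gs) →
      ∀ {g} → S g → Q {0} (λ _ → g)
    chain-induction Q step {g} g∈ = go (suc n) 0 (≡.cong suc (ℕ.+-identityʳ n)) (λ _ → g) (λ _ → g∈) (λ _ ())
      where
      n = proj₁ (chainBound H N norm)
      go : ∀ fuel m → fuel + m ≡ suc n → (gs : Fin (suc m) → Carrier) → (∀ i → S (gs i)) → Chain m gs → Q gs
      go zero m ≡.refl gs gs∈ chain =
        ⊥-elim (ℕ.<-irrefl ≡.refl (proj₂ (proj₂ (chainBound H N norm)) m gs (λ i → S⊆H (gs∈ i)) chain))
      go (suc fuel) m eq gs gs∈ chain = step gs gs∈ λ g g∈ large →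
        go fuel (suc m) (≡.trans (ℕ.+-suc fuel m) eq) (snoc gs g) (snoc-All {P = S} gs gs∈ g∈) (extend-chain chain large)

  abstract
    -- With a constant goal, `chain-induction` becomes a search for a chain that no element of S
    -- prolongs.
    maximalChain : ∀ H N (norm : NormalizedBy ⟨ N ⟩ ⟨ H ⟩) (S : Pred (lsuc (c ⊔ ℓ))) → (∀ {x} → S x → ⟨ H ⟩ x) →
      ∀ {g₀} → S g₀ → ∃ λ m → Σ (Fin m → Carrier) λ gs → (∀ i → S (gs i)) × ∃ λ d →
        ∀ g → S g → IndexBelow d (λ x → CentMod ⟨ H ⟩ ⟨ N ⟩ gs x × ⟨ N ⟩ [ x , g ]) (CentMod ⟨ H ⟩ ⟨ N ⟩ gs)
    maximalChain H N norm S S⊆H = chain-induction (λ {m} gs → Maximal) λ {m} gs gs∈ extend → case gs gs∈ extend em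
      where
      open ChainInduction H N norm S S⊆H
      Maximal : Set (lsuc (c ⊔ ℓ))
      Maximal = ∃ λ m → Σ (Fin m → Carrier) λ gs → (∀ i → S (gs i)) × ∃ λ d →
        ∀ g → S g → IndexBelow d (λ x → C gs x × ⟨ N ⟩ [ x , g ]) (C gs)
      case : ∀ {m} (gs : Fin (suc m) → Carrier) → (∀ i → S (gs i)) →
        (∀ g → S g → IndexAtLeast d (C (snoc gs g)) (C gs) → Maximal) →
        Dec (Σ Carrier λ g → S g × IndexAtLeast d (C (snoc gs g)) (C gs)) → Maximal
      case gs gs∈ extend (yes (g , g∈ , large)) = extend g g∈ large
      case gs gs∈ extend (no none) = _ , gs , gs∈ , d , λ g g∈ → below λ (x , x∈ , distinct) →
        none (g , g∈ , x , x∈ , λ i j i≢j u → distinct i j i≢j (C-snoc u))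

  -- Almost centralisers and their symmetry.

  comm : ∀ {n} → Term n → Term n → Term n
  comm s t = ((inv s · inv t) · s) · t

  module _ (H E : DefinableSubgroup) (norm : NormalizedBy ⟨ E ⟩ ⟨ H ⟩) where
    private
      module H = DefinableSubgroup H
      module E = DefinableSubgroup E

    norm⁻¹ : ∀ {h x} → ⟨ H ⟩ h → ⟨ E ⟩ x → ⟨ E ⟩ (h ⁻¹ ∙ x ∙ h)
    norm⁻¹ {h} {x} h∈ x∈ = E.resp (solve 2 (λ h x → ⊖ h ⊕ x ⊕ ⊖ ⊖ h ⊜ ⊖ h ⊕ x ⊕ h) refl h x) (norm (H.⁻¹-closed h∈) x∈)

    centraliser : ∀ {m} → (Fin m → Carrier) → DefinableSubgroup
    centraliser {m} gs = record
      { ⟨_⟩ = CentMod ⟨ H ⟩ ⟨ E ⟩ gs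
      ; definable = andᴰ H.definable (allFinᴰ m λ i →
          substᴰ (λ { zero → inj₁ zero ; (suc _) → inj₂ (gs i) }) (λ { ρ zero → ρ zero ; ρ (suc _) → gs i })
            (λ { ρ zero → refl ; ρ (suc _) → refl })
            (memberᴰ E.definable E.resp (comm (var zero) (var (suc (zero {0}))))))
      ; isSubgroup = record
        { resp = λ eq (u , v) → H.resp eq u , λ i → proj₂ (S.resp i eq (u , v i))
        ; ε∈ = H.ε∈ , λ i → proj₂ (S.ε∈ i)
        ; ∙-closed = λ (u , v) (u′ , v′) → H.∙-closed u u′ , λ i → proj₂ (S.∙-closed i (u , v i) (u′ , v′ i))
        ; ⁻¹-closed = λ (u , v) → H.⁻¹-closed u , λ i → proj₂ (S.⁻¹-closed i (u , v i))
        }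
      }
      where module S i = IsSubgroup (centraliser-isSubgroup {h = gs i} H.isSubgroup E.isSubgroup norm⁻¹ norm)

    module _ (X : DefinableSubgroup) (X⊆H : ∀ {x} → ⟨ X ⟩ x → ⟨ H ⟩ x) where
      private module X = DefinableSubgroup X

      Cᴱ : Carrier → Pred (c ⊔ ℓ)
      Cᴱ h x = ⟨ X ⟩ x × ⟨ E ⟩ [ x , h ]

      Cᴱ-isSubgroup : ∀ h → IsSubgroup (Cᴱ h)
      Cᴱ-isSubgroup h = centraliser-isSubgroup X.isSubgroup E.isSubgroup (λ x∈ → norm⁻¹ (X⊆H x∈)) (λ x∈ → norm (X⊆H x∈))

      -- Quantifying over d representatives makes the index condition first-order in h; a uniform
      -- bound then makes almost centralisers definable.
      indexᴰ : ∀ d → Definable {1} (λ ρ → IndexAtLeast d (Cᴱ (ρ zero)) ⟨ X ⟩)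
      indexᴰ d = iffᴰ {P = λ ρ → Σ (Env d) λ x → Distinct (prepend d x ρ)} (λ ρ → mk⇔
          (λ (x , u , v) → (λ i → prepend d x ρ (i Fin.↑ˡ 1)) , u , λ i j i≢j (w , w′) →
             v i j i≢j (w , E.resp (comm-cong refl (reflexive (≡.sym (last x ρ)))) w′))
          (λ (x , u , v) → x , (λ i → X.resp (reflexive (≡.sym (front x ρ i))) (u i)) , λ i j i≢j (w , w′) →
             let eq = ∙-cong (⁻¹-cong (reflexive (front x ρ i))) (reflexive (front x ρ j)) in
             v i j i≢j (X.resp eq w , E.resp (comm-cong eq (reflexive (last x ρ))) w′)))
        (exsᴰ d {P = Distinct}
          (andᴰ (allFinᴰ d λ i → memberᴰ X.definable X.resp (var (i Fin.↑ˡ 1)))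
                (allFinᴰ d λ i → allFinᴰ d λ j → different i j)))
        where
        Distinct : Env (d + 1) → Set (c ⊔ ℓ)
        Distinct y = (∀ i → ⟨ X ⟩ (y (i Fin.↑ˡ 1))) × (∀ i j → ¬ i ≡ j →
             ¬ (⟨ X ⟩ (y (i Fin.↑ˡ 1) ⁻¹ ∙ y (j Fin.↑ˡ 1)) × ⟨ E ⟩ [ y (i Fin.↑ˡ 1) ⁻¹ ∙ y (j Fin.↑ˡ 1) , y (d Fin.↑ʳ zero) ]))
        front : ∀ x ρ i → prepend {1} d x ρ (i Fin.↑ˡ 1) ≡ x i
        front x ρ i = ≡.cong [ x , ρ ]′ (Fin.splitAt-↑ˡ d i 1)
        last : ∀ x ρ → prepend {1} d x ρ (d Fin.↑ʳ zero) ≡ ρ zero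
        last x ρ = ≡.cong [ x , ρ ]′ (Fin.splitAt-↑ʳ d 1 zero)
        quotient : Fin d → Fin d → Term (d + 1)
        quotient i j = inv (var (i Fin.↑ˡ 1)) · var (j Fin.↑ˡ 1)
        different : ∀ i j → Definable {d + 1} (λ y → ¬ i ≡ j →
             ¬ (⟨ X ⟩ (y (i Fin.↑ˡ 1) ⁻¹ ∙ y (j Fin.↑ˡ 1)) × ⟨ E ⟩ [ y (i Fin.↑ˡ 1) ⁻¹ ∙ y (j Fin.↑ˡ 1) , y (d Fin.↑ʳ zero) ]))
        -- The inequality of indices is decided outside the formula.
        different i j with i Fin.≟ j
        ... | yes i≡j = iffᴰ (λ y → mk⇔ (λ _ i≢j → ⊥-elim (i≢j i≡j)) (λ _ → tt)) trueᴰ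
        ... | no i≢j = iffᴰ (λ y → mk⇔ (λ u _ → u) (λ u → u i≢j))
          (notᴰ (andᴰ (memberᴰ X.definable X.resp (quotient i j))
                      (memberᴰ E.definable E.resp (comm (quotient i j) (var (d Fin.↑ʳ zero))))))

      FiniteOrbit : Carrier → Set (c ⊔ ℓ)
      FiniteOrbit h = ∃ λ d → IndexBelow d (Cᴱ h) ⟨ X ⟩

      finiteOrbit-isSubgroup : IsSubgroup (λ h → ⟨ H ⟩ h × FiniteOrbit h)
      finiteOrbit-isSubgroup = record
        { resp = λ eq (u , d , small) → H.resp eq u ,
            d , indexBelow-map X.isSubgroup (λ u → u) (λ _ (v , w) → v , E.resp (comm-cong refl eq) w) small
        ; ε∈ = H.ε∈ , 2 , below λ (x , x∈ , distinct) → distinct zero (suc zero) (λ ())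
            (X.∙-closed (X.⁻¹-closed (x∈ zero)) (x∈ (suc zero)) , E.resp (solve 1 (λ y → 𝕖 ⊜ ⟪ y , 𝕖 ⟫) refl _) E.ε∈)
        ; ∙-closed = λ {h} {k} (u , d , small) (v , e , small′) → H.∙-closed u v , suc (d * e) ,
            indexBelow-map X.isSubgroup (λ u → u) (λ {x} x∈ ((_ , w) , (_ , w′)) → x∈ , E.resp
                (solve 3 (λ x h k → ⟪ x , k ⟫ ⊕ (⊖ k ⊕ ⟪ x , h ⟫ ⊕ k) ⊜ ⟪ x , h ⊕ k ⟫) refl x h k)
                (E.∙-closed w′ (norm⁻¹ v w)))
              (index-∩ {d} (Cᴱ-isSubgroup h) (Cᴱ-isSubgroup k) X.isSubgroup small small′)
        ; ⁻¹-closed = λ {h} (u , d , small) → H.⁻¹-closed u , d ,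
            indexBelow-map X.isSubgroup (λ u → u) (λ {x} _ (v , w) → v , E.resp
              (solve 2 (λ x h → h ⊕ ⊖ ⟪ x , h ⟫ ⊕ ⊖ h ⊜ ⟪ x , ⊖ h ⟫) refl x h) (norm u (E.⁻¹-closed w))) small
        }

      -- Take a maximal chain among the elements of finite orbit. Finitely many of them define its
      -- centraliser in X, which therefore has finite index; inside it the centraliser of any such h
      -- has index below a fixed d. The tower bound is independent of h.
      uniformBound : ∃ λ d → ∀ {h} → ⟨ H ⟩ h → FiniteOrbit h → IndexBelow d (Cᴱ h) ⟨ X ⟩
      uniformBound with maximalChain H E norm (λ h → Lift (lsuc (c ⊔ ℓ)) (⟨ H ⟩ h × FiniteOrbit h)) (λ (lift u) → proj₁ u)
        (lift (IsSubgroup.ε∈ finiteOrbit-isSubgroup))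
      ... | m , gs , gs∈ , d , small
        with index-⋂-finite m (λ i → Cᴱ (gs i)) X.isSubgroup (λ i → Cᴱ-isSubgroup (gs i)) (λ i → proj₂ (lower (gs∈ i)))
      ... | e , small′ = suc (e * d) , λ {h} h∈ fin → indexBelow-map X.isSubgroup (λ u → u) (λ x∈ (_ , v) → x∈ , v)
        (index-tower {e} subY (centraliser-isSubgroup {h = h} subY E.isSubgroup (λ (x∈ , _) → norm⁻¹ (X⊆H x∈)) (λ (x∈ , _) → norm (X⊆H x∈)))
          (indexBelow-map X.isSubgroup (λ u → u) (λ x∈ u → x∈ , u) small′)
          (indexBelow-map subY (λ (x∈ , u) → X⊆H x∈ , λ i → proj₂ (u i)) (λ (x∈ , u) (_ , v) → (x∈ , u) , v)
            (small h (lift (h∈ , fin)))))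
        where
        subY : IsSubgroup (λ x → ⟨ X ⟩ x × (∀ i → Cᴱ (gs i) x))
        subY = ∩-isSubgroup X.isSubgroup (⋂-isSubgroup (λ i → Cᴱ-isSubgroup (gs i)))

      -- Together, `finiteOrbit` and `contains` determine `definedBy`: all h ∈ H whose centraliser
      -- modulo E has finite index in X, with one bound for all these indices.
      record AlmostCentraliser : Set (lsuc (c ⊔ ℓ)) where
        field
          bound       : ℕ
          definedBy   : DefinableSubgroup
          ⊆H          : ∀ {h} → ⟨ definedBy ⟩ h → ⟨ H ⟩ h
          finiteOrbit : ∀ {h} → ⟨ definedBy ⟩ h → IndexBelow bound (Cᴱ h) ⟨ X ⟩
          contains    : ∀ {h} → ⟨ H ⟩ h → FiniteOrbit h → ⟨ definedBy ⟩ h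

      fromBound : ∀ d → (∀ {h} → ⟨ H ⟩ h → FiniteOrbit h → IndexBelow d (Cᴱ h) ⟨ X ⟩) → AlmostCentraliser
      fromBound d bounded = record
        { bound = d
        ; definedBy = record
          { ⟨_⟩ = λ h → ⟨ H ⟩ h × ¬ IndexAtLeast d (Cᴱ h) ⟨ X ⟩
          ; definable = andᴰ H.definable (notᴰ (indexᴰ d))
          ; isSubgroup = record
            { resp = λ eq u → close (F.resp eq (finite u))
            ; ε∈ = close F.ε∈
            ; ∙-closed = λ u v → close (F.∙-closed (finite u) (finite v))
            ; ⁻¹-closed = λ u → close (F.⁻¹-closed (finite u))
            }
          }
        ; ⊆H = proj₁
        ; finiteOrbit = λ (_ , small) → below small
        ; contains = λ u fin → close (u , fin)
        }
        where
        module F = IsSubgroup finiteOrbit-isSubgroup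
        finite : ∀ {h} → ⟨ H ⟩ h × ¬ IndexAtLeast d (Cᴱ h) ⟨ X ⟩ → ⟨ H ⟩ h × FiniteOrbit h
        finite (u , small) = u , d , below small
        close : ∀ {h} → ⟨ H ⟩ h × FiniteOrbit h → ⟨ H ⟩ h × ¬ IndexAtLeast d (Cᴱ h) ⟨ X ⟩
        close (u , fin) = u , ¬atLeast (bounded u fin)

      abstract
        almostCentraliser : AlmostCentraliser
        almostCentraliser = fromBound (proj₁ uniformBound) (proj₂ uniformBound)

  normaliser : DefinableSubgroup → DefinableSubgroup
  normaliser E = record
    -- Both inclusions are required, since hEh⁻¹ ≤ E alone is not closed under inverses.
    { ⟨_⟩ = λ h → ∀ x → E.⟨_⟩ x → E.⟨_⟩ (h ∙ x ∙ h ⁻¹) × E.⟨_⟩ (h ⁻¹ ∙ x ∙ h)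
    ; definable = allᴰ (impᴰ (memberᴰ E.definable E.resp x)
        (andᴰ (memberᴰ E.definable E.resp ((h · x) · inv h)) (memberᴰ E.definable E.resp ((inv h · x) · h))))
    ; isSubgroup = record
      { resp = λ eq u x x∈ → E.resp (∙-cong (∙-congʳ eq) (⁻¹-cong eq)) (proj₁ (u x x∈)) ,
                             E.resp (∙-cong (∙-congʳ (⁻¹-cong eq)) eq) (proj₂ (u x x∈))
      ; ε∈ = λ x x∈ → E.resp (solve 1 (λ x → x ⊜ 𝕖 ⊕ x ⊕ ⊖ 𝕖) refl x) x∈ , E.resp (solve 1 (λ x → x ⊜ ⊖ 𝕖 ⊕ x ⊕ 𝕖) refl x) x∈
      ; ∙-closed = λ {g} {h} u v x x∈ →
          E.resp (solve 3 (λ g h x → g ⊕ (h ⊕ x ⊕ ⊖ h) ⊕ ⊖ g ⊜ (g ⊕ h) ⊕ x ⊕ ⊖ (g ⊕ h)) refl g h x) (proj₁ (u _ (proj₁ (v x x∈)))) ,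
          E.resp (solve 3 (λ g h x → ⊖ h ⊕ (⊖ g ⊕ x ⊕ g) ⊕ h ⊜ ⊖ (g ⊕ h) ⊕ x ⊕ (g ⊕ h)) refl g h x) (proj₂ (v _ (proj₂ (u x x∈))))
      ; ⁻¹-closed = λ {h} u x x∈ →
          E.resp (solve 2 (λ h x → ⊖ h ⊕ x ⊕ h ⊜ ⊖ h ⊕ x ⊕ ⊖ ⊖ h) refl h x) (proj₂ (u x x∈)) ,
          E.resp (solve 2 (λ h x → h ⊕ x ⊕ ⊖ h ⊜ ⊖ ⊖ h ⊕ x ⊕ ⊖ h) refl h x) (proj₁ (u x x∈))
      }
    }
    where
    module E = DefinableSubgroup E
    x h : Term 2
    x = var zero
    h = var (suc zero)

  -- If x₀, …, x_d lie in distinct cosets of W, every xᵢ⁻¹xⱼ has infinite orbit under Y, so by Neumann's lemma a single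
  -- y ∈ Y commutes with none of them modulo E.
  module _ (H E : DefinableSubgroup) (norm : NormalizedBy ⟨ E ⟩ ⟨ H ⟩)
    (X : DefinableSubgroup) (X⊆H : ∀ {x} → ⟨ X ⟩ x → ⟨ H ⟩ x)
    (Y : DefinableSubgroup) (Y⊆H : ∀ {y} → ⟨ Y ⟩ y → ⟨ H ⟩ y) (W : AlmostCentraliser H E norm Y Y⊆H) where
    private
      module E = DefinableSubgroup E
      module X = DefinableSubgroup X
      module Y = DefinableSubgroup Y
      module W = AlmostCentraliser W

    almostCentraliser-sym : ∀ {d} → (∀ {y} → ⟨ Y ⟩ y → IndexBelow d (Cᴱ H E norm X X⊆H y) ⟨ X ⟩) →
      IndexBelow d ⟨ W.definedBy ⟩ ⟨ X ⟩
    almostCentraliser-sym {zero} small = ⊥-elim (¬atLeast (small Y.ε∈) ((λ ()) , (λ ()) , λ ()))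
    almostCentraliser-sym {suc d} small = below contra
      where
      module Contra (x : Fin (suc d) → Carrier) (x∈ : ∀ i → ⟨ X ⟩ (x i))
        (distinct : ∀ i j → ¬ i ≡ j → ¬ ⟨ W.definedBy ⟩ (x i ⁻¹ ∙ x j)) where
        -- `Fin.punchIn i` runs through the indices other than i, so these pairs enumerate the
        -- ordered pairs of distinct indices.
        K : Fin (suc d) × Fin d → Pd
        K (i , k) = Cᴱ H E norm Y Y⊆H (x i ⁻¹ ∙ x (Fin.punchIn i k))
        subK : ∀ ik → IsSubgroup (K ik)
        subK (i , k) = Cᴱ-isSubgroup H E norm Y Y⊆H (x i ⁻¹ ∙ x (Fin.punchIn i k))
        infinite : ∀ ik e → ¬ IndexBelow e (K ik) ⟨ Y ⟩
        infinite (i , k) e fin = distinct i (Fin.punchIn i k) (λ eq → Fin.punchInᵢ≢i i k (≡.sym eq))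
          (W.contains
            (X⊆H (X.∙-closed (X.⁻¹-closed (x∈ i)) (x∈ (Fin.punchIn i k)))) (e , fin))

        outside : Σ Carrier λ y → ⟨ Y ⟩ y × (∀ g k → (g , k) ∈ map (λ k → ε , k) (allFin (suc d * d)) → ¬ K (Fin.remQuot d k) (g ⁻¹ ∙ y))
        outside = neumann (suc d * d) (λ k → K (Fin.remQuot d k)) ⟨ Y ⟩ Y.isSubgroup
          (λ k → subK (Fin.remQuot d k)) (λ k → infinite (Fin.remQuot d k)) (map (λ k → ε , k) (allFin (suc d * d)))
        y = proj₁ outside

        avoid : ∀ ik → ¬ K ik y
        avoid (i , k) u = proj₂ (proj₂ outside) ε (Fin.combine i k) (∈-map⁺ (λ k → ε , k) (∈-allFin (Fin.combine i k)))
          (≡.subst (λ ik → K ik (ε ⁻¹ ∙ y)) (≡.sym (Fin.remQuot-combine i k))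
            (IsSubgroup.resp (subK (i , k)) (solve 1 (λ y → y ⊜ ⊖ 𝕖 ⊕ y) refl y) u))

        distinct′ : ∀ i j → ¬ i ≡ j → ¬ Cᴱ H E norm X X⊆H y (x i ⁻¹ ∙ x j)
        distinct′ i j i≢j (_ , u) = avoid (i , Fin.punchOut i≢j) (proj₁ (proj₂ outside) ,
          ≡.subst (λ j → ⟨ E ⟩ [ y , x i ⁻¹ ∙ x j ]) (≡.sym (Fin.punchIn-punchOut i≢j)) (comm-sym E.isSubgroup u))

      contra : ¬ IndexAtLeast (suc d) ⟨ W.definedBy ⟩ ⟨ X ⟩
      contra (x , x∈ , distinct) = ¬atLeast (small (proj₁ (proj₂ outside))) (x , x∈ , distinct′)
        where open Contra x x∈ distinct

  trivialᴰ : DefinableSubgroup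
  trivialᴰ = record
    { ⟨_⟩ = λ x → Lift c (x ≈ ε)
    ; definable = eqᴰ (var zero) one
    ; isSubgroup = record
      { resp = λ eq (lift u) → lift (trans (sym eq) u)
      ; ε∈ = lift refl
      ; ∙-closed = λ (lift u) (lift v) → lift (trans (∙-cong u v) (identityˡ ε))
      ; ⁻¹-closed = λ (lift u) → lift (trans (⁻¹-cong u) (solve 0 (⊖ 𝕖 ⊜ 𝕖) refl))
      }
    }

  -- Definable approximations to the upper central series.

  module Ladder (D : Pred (lsuc (c ⊔ ℓ))) (subD : IsSubgroup D)
    (locNil : Series.LocallyNilpotent (Restriction.group group D subD) Level.zero em) where
    private
      module D = IsSubgroup subD
      module Γ = Series (Restriction.group group D subD) Level.zero em
    open Restriction group D subD using (indexBelow-restrict; restrict-normal)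

    restrict : DefinableSubgroup → Γ.Pd
    restrict E x = Lift (lsuc (c ⊔ ℓ)) (⟨ E ⟩ (proj₁ x))

    record Approximation (s : ℕ) : Set (lsuc (c ⊔ ℓ)) where
      field
        E          : DefinableSubgroup
        normalised : ∀ {f} → D f → ⟨ normaliser E ⟩ f
        above      : ∀ {x} → Γ.Z s x → ⟨ E ⟩ (proj₁ x)
        class      : ℕ
        under      : ∀ {x} → restrict E x → Γ.Z class x

    initial : Approximation 0
    initial = record
      { E = trivialᴰ
      ; normalised = λ {f} _ x (lift u) → lift (trans (∙-congʳ (∙-congˡ u)) (solve 1 (λ f → f ⊕ 𝕖 ⊕ ⊖ f ⊜ 𝕖) refl f)) ,
                                          lift (trans (∙-congʳ (∙-congˡ u)) (solve 1 (λ f → ⊖ f ⊕ 𝕖 ⊕ f ⊜ 𝕖) refl f))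
      ; above = λ (lift u) → lift u
      ; class = 0
      ; under = λ (lift (lift u)) → lift u
      }

    module Step {s} (A : Approximation s) where
      open Approximation A
      module E = DefinableSubgroup E

      H : DefinableSubgroup
      H = normaliser E

      norm : NormalizedBy ⟨ E ⟩ ⟨ H ⟩
      norm h∈ x∈ = proj₁ (h∈ _ x∈)

      Eᴳ-normal : Γ.NormalSubgroup (restrict E)
      Eᴳ-normal = restrict-normal E.isSubgroup (λ g∈ x∈ → norm (normalised g∈) x∈)

      chain = maximalChain H E norm D normalised D.ε∈
      m = proj₁ chain
      gs = proj₁ (proj₂ chain)
      gs∈ = proj₁ (proj₂ (proj₂ chain))
      d = proj₁ (proj₂ (proj₂ (proj₂ chain)))
      small : ∀ f → D f → IndexBelow d (λ x → CentMod ⟨ H ⟩ ⟨ E ⟩ gs x × ⟨ E ⟩ [ x , f ]) (CentMod ⟨ H ⟩ ⟨ E ⟩ gs)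
      small = proj₂ (proj₂ (proj₂ (proj₂ chain)))

      X : DefinableSubgroup
      X = centraliser H E norm gs

      hull = locNil (tabulate (λ i → gs i , gs∈ i))
      M′ = proj₁ hull
      M′-normal = proj₁ (proj₂ hull)
      M′-nilpotent = proj₁ (proj₂ (proj₂ hull))

      gs∈M′ : ∀ i → M′ (gs i , gs∈ i)
      gs∈M′ = tabulate⁻ (proj₂ (proj₂ (proj₂ hull)))

      B : Γ.Pd
      B = Γ.Cent M′ (restrict E)

      -- M′ contains the gᵢ, so B ≤ X, and centralisers modulo E of elements of D have index below d
      -- in B.
      fixed = Γ.boundedCentralisers⇒Up locNil {B = B} Eᴳ-normal B-normal λ f →
          indexBelow-restrict (Γ.NormalSubgroup.isSubgroup B-normal)
            (λ {x} u → normalised (proj₂ x) , λ i → lower (u (gs i , gs∈ i) (gs∈M′ i)))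
            (λ u (_ , v) → u , lift v) (small (proj₁ f) (proj₂ f))
        where
        B-normal : Γ.NormalSubgroup B
        B-normal = Γ.cent-normal M′-normal Eᴳ-normal

      toZ : ∀ k {x} → Γ.Up (restrict E) Γ.Whole k x → Γ.Z (k + class) x
      toZ k u = Γ.Up-+ class k (Γ.Up-resp-⊆ under (λ u → u) k u)

      module Y′ = AlmostCentraliser (almostCentraliser H E norm X proj₁)
      Y : DefinableSubgroup
      Y = Y′.definedBy

      D⊆Y : ∀ {f} → D f → ⟨ Y ⟩ f
      D⊆Y {f} f∈ = Y′.contains (normalised f∈) (d , small f f∈)

      almost = almostCentraliser H E norm Y Y′.⊆H
      module W′ = AlmostCentraliser almost
      W : DefinableSubgroup
      W = W′.definedBy
      module W = DefinableSubgroup W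
      module Y = DefinableSubgroup Y

      -- Conjugation by f ∈ D preserves Y and E, so the centraliser of fwf⁻¹ has the same index
      -- bound as that of w.
      W-conj : ∀ {f w} → D f → ⟨ W ⟩ w → ⟨ W ⟩ (f ∙ w ∙ f ⁻¹)
      W-conj {f} {w} f∈ w∈ = W′.contains
        (H.∙-closed (H.∙-closed (normalised f∈) (W′.⊆H w∈)) (H.⁻¹-closed (normalised f∈)))
        (_ , below λ (x , x∈ , distinct) → ¬atLeast (W′.finiteOrbit w∈)
          ((λ i → f ⁻¹ ∙ x i ∙ f) , (λ i → Y.∙-closed (Y.∙-closed (Y.⁻¹-closed (D⊆Y f∈)) (x∈ i)) (D⊆Y f∈)) ,
           λ i j i≢j (_ , u) → distinct i j i≢j (Y.∙-closed (Y.⁻¹-closed (x∈ i)) (x∈ j) , E.resp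
             (solve 4 (λ f x y w → f ⊕ ⟪ ⊖ (⊖ f ⊕ x ⊕ f) ⊕ (⊖ f ⊕ y ⊕ f) , w ⟫ ⊕ ⊖ f ⊜ ⟪ ⊖ x ⊕ y , f ⊕ w ⊕ ⊖ f ⟫)
                refl f (x i) (x j) w)
             (norm (normalised f∈) u))))
        where module H = DefinableSubgroup H

      Wᴳ-normal : Γ.NormalSubgroup (restrict W)
      Wᴳ-normal = restrict-normal W.isSubgroup W-conj

      -- As D ≤ Y, the elements of W ∩ D have centralisers modulo E of bounded index in D.
      orbits = Γ.boundedOrbits⇒Up locNil {V = restrict W} Eᴳ-normal λ v (lift v∈) →
        indexBelow-restrict (Γ.NormalSubgroup.isSubgroup Γ.whole-normal) (λ {x} _ → D⊆Y (proj₂ x)) (λ _ (_ , u) → lift u)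
          (W′.finiteOrbit v∈)

      -- Elements that M′ centralises modulo E lie in B, where `fixed` applies.
      W-bounded : ∃ λ n → ∀ {x} → restrict W x → Γ.Up (restrict E) Γ.Whole n x
      W-bounded = Γ.nilpotentAction Wᴳ-normal Eᴳ-normal M′-normal {proj₁ orbits} {suc (proj₁ M′-nilpotent)} {proj₁ fixed}
        (proj₂ orbits)
        (λ {x} _ g g∈ → Γ.nilpotent⇒Up Eᴳ-normal M′-nilpotent (Γ.NormalSubgroup.commʳ M′-normal x {g} g∈))
        (λ _ u → proj₂ fixed u)

      Zₛ⊆X : ∀ {z} → Γ.Z (suc s) z → ⟨ X ⟩ (proj₁ z)
      Zₛ⊆X {z} u = normalised (proj₂ z) , λ i → above (u (gs i , gs∈ i) tt)

      cosets : Γ.Cover _ (restrict W) (Γ.Z (suc s))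
      cosets = Γ.index⇒cover (Γ.NormalSubgroup.isSubgroup Wᴳ-normal)
        (indexBelow-restrict (Γ.NormalSubgroup.isSubgroup (Γ.Z-normal (suc s))) Zₛ⊆X (λ _ u → lift u)
          (almostCentraliser-sym H E norm X proj₁ Y Y′.⊆H almost Y′.finiteOrbit))
      r = proj₁ cosets
      z : Fin r → Γ.Carrier
      z = proj₁ (proj₂ (proj₂ cosets))
      z∈ : ∀ i → Γ.Z (suc s) (z i)
      z∈ = proj₁ (proj₂ (proj₂ (proj₂ cosets)))

      -- The product Z (suc s) W, written as a finite union of cosets of W to make it definable.
      ZW : Pred (c ⊔ ℓ)
      ZW h = Σ (Fin r) λ i → ⟨ W ⟩ (proj₁ (z i) ⁻¹ ∙ h)

      inZW : ∀ {h} x → Γ.Z (suc s) x → ⟨ W ⟩ (proj₁ x ⁻¹ ∙ h) → ZW h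
      inZW {h} x x∈ u = let i , lift v = proj₂ (proj₂ (proj₂ (proj₂ cosets))) x x∈ in i ,
        W.resp (solve 3 (λ z x h → (⊖ z ⊕ x) ⊕ (⊖ x ⊕ h) ⊜ ⊖ z ⊕ h) refl (proj₁ (z i)) (proj₁ x) h) (W.∙-closed v u)

      W-conj⁻¹ : ∀ {f w} → D f → ⟨ W ⟩ w → ⟨ W ⟩ (f ⁻¹ ∙ w ∙ f)
      W-conj⁻¹ {f} {w} f∈ w∈ = W.resp (solve 2 (λ f w → ⊖ f ⊕ w ⊕ ⊖ ⊖ f ⊜ ⊖ f ⊕ w ⊕ f) refl f w) (W-conj (D.⁻¹-closed f∈) w∈)

      module Zₛ = Γ.NormalSubgroup (Γ.Z-normal (suc s))

      ZW-conj : ∀ {f h} → D f → ZW h → ZW (f ∙ h ∙ f ⁻¹)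
      ZW-conj {f} {h} f∈ (i , u) = inZW ((f , f∈) Γ.∙ z i Γ.∙ (f , f∈) Γ.⁻¹) (Zₛ.isNormal (f , f∈) {z i} (z∈ i)) (W.resp
        (solve 3 (λ f z h → f ⊕ (⊖ z ⊕ h) ⊕ ⊖ f ⊜ ⊖ (f ⊕ z ⊕ ⊖ f) ⊕ (f ⊕ h ⊕ ⊖ f)) refl f (proj₁ (z i)) h) (W-conj f∈ u))

      ZWᴰ : DefinableSubgroup
      ZWᴰ = record
        { ⟨_⟩ = ZW
        ; definable = exFinᴰ r λ i →
            substᴰ (λ { zero → inj₁ zero ; (suc _) → inj₂ (proj₁ (z i)) }) (λ { ρ zero → ρ zero ; ρ (suc _) → proj₁ (z i) })
              (λ { ρ zero → refl ; ρ (suc _) → refl })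
              (memberᴰ W.definable W.resp (inv (var (suc (zero {0}))) · var zero))
        ; isSubgroup = record
          { resp = λ eq (i , u) → i , W.resp (∙-congˡ eq) u
          ; ε∈ = inZW Γ.ε Zₛ.ε∈ (W.resp (solve 0 (𝕖 ⊜ ⊖ 𝕖 ⊕ 𝕖) refl) W.ε∈)
          ; ∙-closed = λ {g} {h} (i , u) (j , v) → inZW (z i Γ.∙ z j) (Zₛ.∙-closed {z i} {z j} (z∈ i) (z∈ j)) (W.resp
              (solve 4 (λ x y g h → (⊖ y ⊕ (⊖ x ⊕ g) ⊕ y) ⊕ (⊖ y ⊕ h) ⊜ ⊖ (x ⊕ y) ⊕ (g ⊕ h)) refl (proj₁ (z i)) (proj₁ (z j)) g h)
              (W.∙-closed (W-conj⁻¹ (proj₂ (z j)) u) v))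
          ; ⁻¹-closed = λ {h} (i , u) → inZW (z i Γ.⁻¹) (Zₛ.⁻¹-closed {z i} (z∈ i)) (W.resp
              (solve 2 (λ z h → z ⊕ ⊖ (⊖ z ⊕ h) ⊕ ⊖ z ⊜ ⊖ ⊖ z ⊕ ⊖ h) refl (proj₁ (z i)) h)
              (W-conj (proj₂ (z i)) (W.⁻¹-closed u)))
          }
        }

      next : Approximation (suc s)
      next = record
        { E = ZWᴰ
        ; normalised = λ {f} f∈ x x∈ → ZW-conj f∈ x∈ , DefinableSubgroup.resp ZWᴰ
            (solve 2 (λ f w → ⊖ f ⊕ w ⊕ ⊖ ⊖ f ⊜ ⊖ f ⊕ w ⊕ f) refl f x) (ZW-conj (D.⁻¹-closed f∈) x∈)
        ; above = λ {x} u → inZW x u (W.resp (sym (inverseˡ _)) W.ε∈)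
        -- Write x = zᵢw with zᵢ ∈ Z (suc s) and w ∈ W ∩ D; the sum of the two levels bounds both
        -- factors.
        ; class = suc s + (proj₁ W-bounded + class)
        ; under = λ {x} (lift (i , u)) → let w = z i Γ.⁻¹ Γ.∙ x ; k = suc s + (proj₁ W-bounded + class) in
            Γ.cancel-left (Γ.NormalSubgroup.isSubgroup (Γ.Z-normal k)) {z i} {x}
              (Γ.Z-≤ (ℕ.m≤m+n (suc s) _) {z i} (z∈ i))
              (Γ.Z-≤ (ℕ.m≤n+m _ (suc s)) {w} (toZ (proj₁ W-bounded) {w} (proj₂ W-bounded {w} (lift u))))
        }

    approximation : ∀ s → Approximation s
    approximation zero    = initial
    approximation (suc s) = Step.next (approximation s)

    -- The M′ of the step at s serves: whatever centralises it modulo Z s does so modulo E, hence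
    -- lies in B.
    centralisersInHypercentre : Γ.CentralisersInHypercentre
    centralisersInHypercentre s = M′ , M′-normal , M′-nilpotent , proj₁ fixed + class ,
      λ {x} u → toZ (proj₁ fixed) (proj₂ fixed λ g g∈ → lift (above (u g g∈)))
      where
      open Approximation (approximation s)
      open Step (approximation s)

-- Nilpotency of the Fitting subgroup.

module FittingSubgroup {L : Language} {c ℓ : Level} (em : ExcludedMiddle (lsuc (c ⊔ ℓ)))
  (M : Structure L c ℓ) (mc : IsMcTilde M) where
  open Structure M using (group)
  open Definability M using (trueᴰ)
  open Envelope em M mc
  open Series group ℓ em₀
  open WordSolver group using (solve; _⊜_; _⊕_; ⊖_; 𝕖; ⟪_,_⟫)
  open DefinableSubgroup using (⟨_⟩)

  UpperCentral⇒Up : ∀ {N : Pd} k {x} → UpperCentral N k x → Up Trivial N k x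
  UpperCentral⇒Up zero (lift u) = lift u
  UpperCentral⇒Up (suc k) (_ , u) y y∈ = UpperCentral⇒Up k (u y y∈)

  Up⇒UpperCentral : ∀ {N : Pd} → NormalSubgroup N → ∀ k {x} → N x → Up Trivial N k x → UpperCentral N k x
  Up⇒UpperCentral nN zero x∈ (lift u) = lift u
  Up⇒UpperCentral nN (suc k) x∈ u = x∈ , λ y y∈ → Up⇒UpperCentral nN k (NormalSubgroup.commˡ nN y x∈) (u y y∈)

  record NormalNilpotent : Set (lsuc (c ⊔ ℓ)) where
    field
      N         : Pd
      normal    : NormalSubgroup N
      nilpotent : Nilpotent N
    open NormalSubgroup normal public
  open NormalNilpotent using (N)

  product : NormalNilpotent → NormalNilpotent → NormalNilpotent
  product A B = record
    { N = A.N · B.N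
    ; normal = ·-normal A.normal B.normal
    ; nilpotent = fitting A.normal B.normal A.nilpotent B.nilpotent }
    where module A = NormalNilpotent A
          module B = NormalNilpotent B

  productˡ : ∀ A B {x} → N A x → N (product A B) x
  productˡ A B {x} x∈ = x , ε , x∈ , NormalNilpotent.ε∈ B , sym (identityʳ x)

  productʳ : ∀ A B {x} → N B x → N (product A B) x
  productʳ A B {x} x∈ = ε , x , NormalNilpotent.ε∈ A , x∈ , sym (identityˡ x)

  trivial : NormalNilpotent
  trivial = record { N = Trivial ; normal = trivial-normal ; nilpotent = 0 , λ u → u }

  -- By Fitting's theorem a single normal nilpotent subgroup suffices for each element of the
  -- Fitting subgroup.
  Covered : Carrier → Set (lsuc (c ⊔ ℓ))
  Covered x = Σ NormalNilpotent λ A → N A x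

  fitting⇒covered : ∀ {x} → Fitting x → Covered x
  fitting⇒covered (xs , xs∈ , x≈) = let A , u = go xs xs∈ in A , NormalNilpotent.resp A (sym x≈) u
    where
    go : ∀ xs → All InNormalNilpotent xs → Covered (prod xs)
    go [] [] = trivial , lift refl
    go (x ∷ xs) ((N , sub , nor , (k , nil) , x∈) ∷ xs∈) =
      let B , u = go xs xs∈
          A = record
            { N = N
            ; normal = record { isSubgroup = sub ; isNormal = nor }
            ; nilpotent = k , λ {y} y∈ → UpperCentral⇒Up k (nil y y∈) }
      in product A B , NormalNilpotent.∙-closed (product A B) (productˡ A B x∈) (productʳ A B u)

  covered⇒fitting : ∀ {x} → Covered x → Fitting x
  covered⇒fitting {x} (A , x∈) = x ∷ [] ,
    (A.N , A.isSubgroup , NormalSubgroup.isNormal A.normal ,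
     (proj₁ A.nilpotent , λ y y∈ → Up⇒UpperCentral A.normal (proj₁ A.nilpotent) y∈ (proj₂ A.nilpotent y∈)) , x∈) ∷ [] ,
    sym (identityʳ x)
    where module A = NormalNilpotent A

  fitting-isSubgroup : IsSubgroup Fitting
  fitting-isSubgroup = record
    { resp = λ x≈y (xs , xs∈ , x≈) → xs , xs∈ , trans (sym x≈y) x≈
    ; ε∈ = covered⇒fitting (trivial , lift refl)
    ; ∙-closed = λ u v → let A , x∈ = fitting⇒covered u ; B , y∈ = fitting⇒covered v in
        covered⇒fitting (product A B , NormalNilpotent.∙-closed (product A B) (productˡ A B x∈) (productʳ A B y∈))
    ; ⁻¹-closed = λ u → let A , x∈ = fitting⇒covered u in covered⇒fitting (A , NormalNilpotent.⁻¹-closed A x∈)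
    }

  module _ (D : Pred (lsuc (c ⊔ ℓ))) (subD : IsSubgroup D) (D⊆Fitting : ∀ {x} → D x → Fitting x) where
    private module Γ = Series (Restriction.group group D subD) Level.zero em

    locallyNilpotent : Γ.LocallyNilpotent
    locallyNilpotent xs = let A , xs∈ = hull xs in
      (λ x → Lift (lsuc (c ⊔ ℓ)) (N A (proj₁ x))) ,
      Restriction.restrict-normal group D subD (NormalNilpotent.isSubgroup A) (λ _ → NormalSubgroup.isNormal (NormalNilpotent.normal A) _) ,
      (proj₁ (NormalNilpotent.nilpotent A) , λ (lift u) → restrict-Up A (proj₁ (NormalNilpotent.nilpotent A)) (proj₂ (NormalNilpotent.nilpotent A) u)) ,
      All.map lift xs∈
      where
      hull : (xs : List Γ.Carrier) → Σ NormalNilpotent λ A → All (λ x → N A (proj₁ x)) xs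
      hull [] = trivial , []
      hull ((x , x∈) ∷ xs) =
        let A , u = fitting⇒covered (D⊆Fitting x∈)
            B , us = hull xs
        in product A B , productˡ A B u ∷ All.map (productʳ A B) us

      restrict-Up : ∀ A k {x} → Up Trivial (N A) k (proj₁ x) → Γ.Up Γ.Trivial (λ x → Lift (lsuc (c ⊔ ℓ)) (N A (proj₁ x))) k x
      restrict-Up A zero (lift u) = lift u
      restrict-Up A (suc k) u (y , _) (lift y∈) = restrict-Up A k (u y y∈)

    criterion : ∀ d → (∀ x → Γ.Nilpotent (Γ.Cᵍ x) ⊎ Γ.IndexBelow d (Γ.Cᵍ x) Γ.Whole) → ∃ λ n → ∀ x → Γ.Z n x
    criterion = Γ.nilpotent-criterion locallyNilpotent (Ladder.centralisersInHypercentre D subD locallyNilpotent)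

  whole : DefinableSubgroup
  whole = record
    { ⟨_⟩ = λ _ → ⊤
    ; definable = trueᴰ
    ; isSubgroup = record { resp = λ _ _ → tt ; ε∈ = tt ; ∙-closed = λ _ _ → tt ; ⁻¹-closed = λ _ → tt } }

  trivial-conj : NormalizedBy ⟨ trivialᴰ ⟩ ⟨ whole ⟩
  trivial-conj {h} _ (lift u) = lift (trans (∙-congʳ (∙-congˡ u)) (solve 1 (λ h → h ⊕ 𝕖 ⊕ ⊖ h ⊜ 𝕖) refl h))

  open ChainInduction whole trivialᴰ trivial-conj Fitting (λ _ → tt)

  F∩C : ∀ {m} → (Fin m → Carrier) → Pred (lsuc (c ⊔ ℓ))
  F∩C gs x = Fitting x × C gs x

  F∩C-isSubgroup : ∀ {m} (gs : Fin m → Carrier) → IsSubgroup (F∩C gs)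
  F∩C-isSubgroup gs = ∩-isSubgroup fitting-isSubgroup (DefinableSubgroup.isSubgroup (centraliser whole trivialᴰ trivial-conj gs))

  module Γ {m} (gs : Fin m → Carrier) = Series (Restriction.group group (F∩C gs) (F∩C-isSubgroup gs)) Level.zero em

  NilpotentBelow : ∀ {m} → (Fin (suc m) → Carrier) → Set (lsuc (c ⊔ ℓ))
  NilpotentBelow gs = ∃ λ k → ∀ x → Γ.Z gs k x

  -- For g ∈ D = F ∩ C(gs), the centraliser of g in D is F ∩ C(gs, g). If C(gs, g) has large index
  -- in C(gs), that group is nilpotent by induction; otherwise its index in D is below d. These are
  -- the alternatives of the criterion.
  nilpotentBelow-step : ∀ {m} (gs : Fin (suc m) → Carrier) → (∀ i → Fitting (gs i)) →
    (∀ g → Fitting g → IndexAtLeast d (C (snoc gs g)) (C gs) → NilpotentBelow (snoc gs g)) → NilpotentBelow gs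
  nilpotentBelow-step gs _ smaller = criterion (F∩C gs) (F∩C-isSubgroup gs) proj₁ d alternatives
    where
    D = F∩C gs
    subD = F∩C-isSubgroup gs

    alternative : ∀ g g∈ g∈C → Dec (IndexAtLeast d (C (snoc gs g)) (C gs)) →
      Γ.Nilpotent gs (Γ.Cᵍ gs (g , g∈ , g∈C)) ⊎ Γ.IndexBelow gs d (Γ.Cᵍ gs (g , g∈ , g∈C)) (Γ.Whole gs)
    alternative g g∈ g∈C (yes large) = inj₁ (proj₁ nil , λ {x} u → transfer (proj₁ nil) x (proj₂ nil (inside x u)))
      where
      nil = smaller g g∈ large
      inside : ∀ x → Γ.Cᵍ gs (g , g∈ , g∈C) x → Γ.Carrier (snoc gs g)
      inside (x , x∈ , x∈C) (lift u) = x , x∈ , snoc-C x∈C (lift u)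
      transfer : ∀ k x {x∈} → Γ.Z (snoc gs g) k (proj₁ x , x∈) →
        Γ.Up gs (Γ.Trivial gs) (Γ.Cᵍ gs (g , g∈ , g∈C)) k x
      transfer zero x (lift v) = lift v
      transfer (suc k) x v y u = transfer k _ (v (inside y u) tt)
    alternative g g∈ g∈C (no small) = inj₂ (Restriction.indexBelow-restrict group D subD {A = C (snoc gs g)} {B = C gs}
      (Γ.NormalSubgroup.isSubgroup (Γ.whole-normal gs)) (λ {x} _ → proj₂ (proj₂ x))
      (λ _ u → lift (lower (proj₂ (C-snoc {gs = gs} {g} u)))) (below small))

    alternatives : ∀ x → Γ.Nilpotent gs (Γ.Cᵍ gs x) ⊎ Γ.IndexBelow gs d (Γ.Cᵍ gs x) (Γ.Whole gs)
    alternatives (g , g∈ , g∈C) = alternative g g∈ g∈C em₀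

  fitting-isNilpotent : IsNilpotent Fitting
  -- The chain starts with ε, whose centraliser is the whole group.
  fitting-isNilpotent = let k , nil = chain-induction NilpotentBelow nilpotentBelow-step (IsSubgroup.ε∈ fitting-isSubgroup)
    in k , λ x x∈ → toUpperCentral k (nil (x , x∈ , tt , λ i → lift (solve 1 (λ x → ⟪ x , 𝕖 ⟫ ⊜ 𝕖) refl x)))
    where
    toUpperCentral : ∀ k {x x∈} → Γ.Z (λ (_ : Fin 1) → ε) k (x , x∈) → UpperCentral Fitting k x
    toUpperCentral zero (lift u) = lift u
    toUpperCentral (suc k) {x} {x∈ , _} u = x∈ , λ y y∈ →
      toUpperCentral k (u (y , y∈ , tt , λ i → lift (solve 1 (λ x → ⟪ x , 𝕖 ⟫ ⊜ 𝕖) refl y)) tt)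

theorem4p4 : ∀ {L c ℓ} → ExcludedMiddle (lsuc (c ⊔ ℓ)) →
    (M : Structure L c ℓ) → IsMcTilde M →
    GroupNotions.IsNilpotent (Structure.group M) (GroupNotions.Fitting (Structure.group M))
theorem4p4 em M mc = FittingSubgroup.fitting-isNilpotent em M mc
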